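{- Let $S=\{x_1,\ldots,x_n\}$ be a factor-closed set of $n$ distinct positive integers, let $k\in\mathbb{N}$, and let $F(r;n_1,\ldots,n_k)$ ($r,n_1,\ldots,n_k\in\mathbb{N}$) be even $\pmod r$ with respect to $n_1,\ldots,n_k$. Let $I=\{2,3,\ldots,k+1\}$ if $k$ is even and $I=\{1,2,\ldots,k+1\}$ if $k$ is odd. Then \[ \det_I\bigl(F(x_{i_1};x_{i_2},\ldots,x_{i_{k+1}})\bigr)_{1\le i_1,\ldots,i_{k+1}\le n}=(x_1\cdots x_n)^k\prod_{v=1}^n\alpha_{x_v}(x_v,\ldots,x_v). \]
   Context: A set $S$ of positive integers is factor-closed if every positive divisor of every element of $S$ lies in $S$. $F$ is even $\pmod r$ if $F(r;n_1,\ldots,n_k)=F(r;\gcd(n_1,r),\ldots,\gcd(n_k,r))$ for all $r,n_1,\ldots,n_k$. $c(k,n):=\sum_{d\mid\gcd(k,n)}\mu(k/d)\,d$ is the Ramanujan sum. The finite Fourier coefficients are, for $d_1,\ldots,d_k\mid r$, \[ \alpha_r(d_1,\ldots,d_k):=\frac{1}{r^k}\sum_{\delta_1,\ldots,\delta_k\mid r}F(r;\delta_1,\ldots,\delta_k)\,c\Bigl(\frac{r}{\delta_1},\frac{r}{d_1}\Bigr)\cdots c\Bigl(\frac{r}{\delta_k},\frac{r}{d_k}\Bigr). \] For a $K$-dimensional matrix $A$ of order $n$ and $J\subseteq\{1,\ldots,K\}$, with $\eta_j=1$ if $j\in J$ and $0$ otherwise, the hyperdeterminant is $\det_JA:=\frac{1}{n!}\sum_{\sigma_1,\ldots,\sigma_K\in\mathfrak{S}_n}\prod_{j=1}^K\mathrm{sgn}(\sigma_j)^{\eta_j}\prod_{v=1}^nA(\sigma_1(v),\ldots,\sigma_K(v))$,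 $\mathfrak{S}_n$ the symmetric group on $\{1,\ldots,n\}$. -}

module Defs where

open import Level using (Level; _⊔_) renaming (suc to lsuc)
open import Algebra.Bundles using (CommutativeRing; Semiring)
import Algebra.Definitions.RawSemiring as RawSemiring
open import Data.Bool.Base using (if_then_else_)
open import Data.Fin.Base using (Fin)
import Data.Fin.Properties as Fin
open import Data.Fin.Subset using (Subset; ⊤; inside; outside)
open import Data.List.Base as List
  using (List; []; _∷_; allFin; cartesianProduct; cartesianProductWith; filter; foldr; length; upTo)
import Data.List.Relation.Unary.Unique.DecPropositional as UniqueList
open import Data.Nat.Base as ℕ using (ℕ; zero; suc; NonZero; _!)
open import Data.Nat.Divisibility using (_∣_; _∣?_)
open import Data.Nat.DivMod using (_/_)
open import Data.Nat.GCD using (gcd)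
open import Data.Nat.Primality.Factorisation using (factorise; factors)
import Data.Nat.Properties as ℕ
open import Data.Product.Base using (_,_)
open import Data.Vec.Base as Vec using (Vec; []; _∷_; lookup)
open import Data.Vec.Relation.Unary.All using (All)
open import Data.Vec.Relation.Unary.AllPairs using (allPairs?)
open import Data.Vec.Relation.Unary.Unique.Propositional using (Unique)
open import Relation.Nullary.Decidable using (Dec; does; ¬?; _×-dec_)
open import Relation.Unary using (Pred)

private
  variable
    a c ℓ : Level
    A : Set a

-- A commutative ring in which every positive integer is invertible; the
-- complex numbers are the motivating instance.
record CommutativeℚAlgebra c ℓ : Set (lsuc (c ⊔ ℓ)) where
  field
    commutativeRing : CommutativeRing c ℓ
  open CommutativeRing commutativeRing public
  field
    recip   : ∀ m → .{{NonZero m}} → Carrier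
    inverse : ∀ m → .{{_ : NonZero m}} → RawSemiring._×_ (Semiring.rawSemiring semiring) m 1# * recip m ≈ 1#

  open RawSemiring (Semiring.rawSemiring semiring) public using (_×_; _^_)

  ι : ℕ → Carrier
  ι m = m × 1#

FactorClosed : Pred ℕ a → Set a
FactorClosed S = ∀ {m d} → S m → NonZero d → d ∣ m → S d

divisors : ℕ → List ℕ
divisors r = filter (_∣? r) (List.map suc (upTo r))

-- Totalised so that it can be applied to list elements; the value at divisor 0
-- is never used.
_div_ : ℕ → ℕ → ℕ
m div zero  = zero
m div suc d = m / suc d

tuples : List A → ∀ m → List (Vec A m)
tuples xs zero    = [] ∷ []
tuples xs (suc m) = cartesianProductWith _∷_ xs (tuples xs m)

unique? : ∀ {n m} (σ : Vec (Fin n) m) → Dec (Unique σ)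
unique? = allPairs? (λ i j → ¬? (i Fin.≟ j))

-- Permutations in one-line notation: σ(v) = lookup σ v.
𝔖 : ∀ n → List (Vec (Fin n) n)
𝔖 n = filter unique? (tuples (allFin n) n)

inversions : ∀ {n} → Vec (Fin n) n → ℕ
inversions {n} σ = length (filter
  (λ (i , j) → (i Fin.<? j) ×-dec (lookup σ j Fin.<? lookup σ i))
  (cartesianProduct (allFin n) (allFin n)))

-- Position zero of the subset stands for the index 1.
I : ∀ k → Subset (suc k)
I k = (if does (2 ∣? k) then outside else inside) ∷ ⊤

module Arithmetic (R : CommutativeℚAlgebra c ℓ) where
  open CommutativeℚAlgebra R

  sumOver : List A → (A → Carrier) → Carrier
  sumOver xs f = foldr (λ x s → f x + s) 0# xs

  prodOver : List A → (A → Carrier) → Carrier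
  prodOver xs f = foldr (λ x p → f x * p) 1# xs

  infix 6 sumOver prodOver
  syntax sumOver  xs (λ x → e) = ∑[ x ∈ xs ] e
  syntax prodOver xs (λ x → e) = ∏[ x ∈ xs ] e

  μ : ℕ → Carrier
  μ zero = 0#
  μ m@(suc _) = if does (UniqueList.unique? ℕ._≟_ ps) then (- 1#) ^ length ps else 0#
    where ps = factors (factorise m)

  ramanujan : ℕ → ℕ → Carrier
  ramanujan k n = ∑[ d ∈ divisors (gcd k n) ] (μ (k div d) * ι d)

  -- F is only constrained, and only ever used, at positive arguments.
  Even : ∀ {k} → (ℕ → Vec ℕ k → Carrier) → Set ℓ
  Even F = ∀ r ns → NonZero r → All NonZero ns → F r ns ≈ F r (Vec.map (λ m → gcd m r) ns)

  -- Meaningful only when every entry of ds divides r.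
  α : ∀ {k} → (ℕ → Vec ℕ k → Carrier) → (r : ℕ) → .{{NonZero r}} → Vec ℕ k → Carrier
  α {k} F r ds = recip (r ℕ.^ k) {{ℕ.m^n≢0 r k}} *
    (∑[ δs ∈ tuples (divisors r) k ]
      (F r δs * (∏[ j ∈ allFin k ] ramanujan (r div lookup δs j) (r div lookup ds j))))

  sgn : ∀ {n} → Vec (Fin n) n → Carrier
  sgn σ = (- 1#) ^ inversions σ

  η : ∀ {K} → Subset K → Fin K → ℕ
  η J j = if lookup J j then 1 else 0

  det : ∀ {K n} → Subset K → (Vec (Fin n) K → Carrier) → Carrier
  det {K} {n} J A = recip (n !) {{n ℕ.!≢0}} *
    (∑[ σs ∈ tuples (𝔖 n) K ]
      ((∏[ j ∈ allFin K ] (sgn (lookup σs j) ^ η J j)) *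
       (∏[ v ∈ allFin n ] A (Vec.map (λ σ → lookup σ v) σs))))

-- Write M(f)(r; d₁,…,d_k) for the Möbius transform Σ_{δ_j ∣ d_j} f(r; δ₁,…,δ_k) Π_j μ(d_j/δ_j).
-- Since S is factor-closed, replacing F by M(F) multiplies the array along each of the directions 2,…,k+1
-- by the matrix [x_e ∣ x_i] μ(x_i/x_e), which becomes unitriangular when S is sorted; all these directions are
-- signed, so the hyperdeterminant does not change.  Since F is even (mod r), M(F)(r; d₁,…,d_k) = 0 unless
-- every d_j divides r: if d ∤ r, choose a prime p with p gcd(d,r) ∣ d; then the divisors c and pc of d, where p ∤ c,
-- contribute opposite terms.  Hence only σ₁ = ⋯ = σ_{k+1} contributes, each such permutation contributes
-- Π_v M(F)(x_v; x_v,…,x_v) because the number of signed directions is even, and M(F)(r; r,…,r) = r^k α_r(r,…,r)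
-- because c(m,1) = μ(m).
module Submission where

open import Defs
open import Algebra.Bundles using (CommutativeMonoid)
open import Data.Bool.Base using (Bool; if_then_else_)
open import Data.Fin.Base using (Fin; zero; suc; punchIn; punchOut)
import Data.Fin.Properties as Fin
open import Data.Fin.Subset using (⊤; inside; outside)
open import Data.List.Base as List using (List; []; _∷_; _++_; allFin; length; upTo; cartesianProduct; cartesianProductWith)
import Data.List.Properties as List
open import Data.List.Membership.Propositional using (_∈_)
open import Data.List.Membership.Propositional.Properties
open import Data.List.Membership.Propositional.Properties.WithK using (unique∧set⇒bag)
open import Data.List.Relation.Binary.BagAndSetEquality using (∼bag⇒↭)
open import Data.List.Relation.Binary.Permutation.Propositional as ↭ using (_↭_; ↭⇒↭ₛ; ↭-sym)
open import Data.List.Relation.Binary.Permutation.Propositional.Properties using (↭-length)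
import Data.List.Relation.Binary.Permutation.Setoid.Properties as Permutation
open import Data.List.Relation.Unary.All as ListAll using ([]; _∷_)
import Data.List.Relation.Unary.All.Properties as ListAll
open import Data.List.Relation.Unary.Any as Any using (here; there)
open import Data.List.Relation.Unary.AllPairs as ListAllPairs using ([]; _∷_)
import Data.List.Relation.Unary.Unique.DecPropositional as UniqueList
import Data.List.Relation.Unary.Unique.Propositional as ListUnique
import Data.List.Relation.Unary.Unique.Propositional.Properties as ListUnique
open import Data.Nat.Base as ℕ using (ℕ; zero; suc; NonZero; _≤_; _!; ≢-nonZero⁻¹)
open import Data.Nat.Coprimality using (Coprime; coprime-factors)
open import Data.Nat.Divisibility
open import Data.Nat.DivMod using (m*n/n≡m; m/n*n≡m; n/1≡n)
open import Data.Nat.GCD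
open import Data.Nat.ListAction using (product)
open import Data.Nat.ListAction.Properties using (∈⇒∣product)
open import Data.Nat.Primality
open import Data.Nat.Primality.Factorisation using (PrimeFactorisation; factorise; factors; factorisationUnique)
import Data.Nat.Properties as ℕ
open import Data.Product.Base using (∃; _×_; _,_; proj₁; proj₂)
open import Data.Sum.Base using (inj₁; inj₂; [_,_]′)
open import Data.Vec.Base as Vec using (Vec; []; _∷_; lookup; head; tail; map; replicate)
import Data.Vec.Properties as Vec
open import Data.Vec.Relation.Unary.All as All using (All; []; _∷_)
import Data.Vec.Relation.Unary.All.Properties as All
open import Data.Vec.Relation.Unary.AllPairs using ([]; _∷_)
open import Data.Vec.Relation.Unary.Unique.Propositional using (Unique)
import Data.Vec.Relation.Unary.Unique.Propositional.Properties as Unique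
open import Function.Base using (_∘_; id; it)
open import Function.Bundles using (mk⇔)
open import Function.Definitions using (Injective)
open import Level using (Level)
open import Relation.Binary.PropositionalEquality as ≡ using (_≡_; _≢_)
open import Relation.Nullary using (¬_; Dec; yes; no; does; contradiction; _×-dec_)
open import Relation.Nullary.Decidable using (toSum; dec-true; dec-false)
open import Relation.Unary using (Pred; Decidable)

private
  variable
    a b o : Level
    A : Set a
    B : Set b
    C : Set o
    c c′ d e p r k m n N : ℕ

-- Permutations and divisors as lists

-- Without repetitions, two lists are rearrangements of each other as soon as their members agree.
-- Every change of summation variable below rests on this.
unique∧set⇒↭ : {xs ys : List A} → ListUnique.Unique xs → ListUnique.Unique ys →
               (∀ {z} → z ∈ xs → z ∈ ys) → (∀ {z} → z ∈ ys → z ∈ xs) → xs ↭ ys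
unique∧set⇒↭ xs! ys! ⊆ ⊇ = ∼bag⇒↭ (unique∧set⇒bag xs! ys! (mk⇔ ⊆ ⊇))

unique-map : {f : A → B} {xs : List A} →
             (∀ {x y} → x ∈ xs → y ∈ xs → f x ≡ f y → x ≡ y) →
             ListUnique.Unique xs → ListUnique.Unique (List.map f xs)
unique-map inj []           = []
unique-map inj (x∉xs ∷ xs!) =
  ListAll.map⁺ (ListAll.tabulate λ y∈xs fx≡fy →
    ListAll.lookup x∉xs y∈xs (inj (here ≡.refl) (there y∈xs) fx≡fy))
  ∷ unique-map (λ x∈ y∈ → inj (there x∈) (there y∈)) xs!

-- Injectivity and surjectivity both come from applying `f` twice. It serves for swaps of positions,
-- for complementary divisors and for `toggle`.
involution-↭ : {f : A → A} {xs : List A} → ListUnique.Unique xs →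
               (∀ {x} → x ∈ xs → f x ∈ xs) → (∀ {x} → x ∈ xs → f (f x) ≡ x) →
               List.map f xs ↭ xs
involution-↭ {f = f} {xs} xs! closed invol = unique∧set⇒↭ (unique-map inj xs!) xs! to from
  where
  inj : ∀ {x y} → x ∈ xs → y ∈ xs → f x ≡ f y → x ≡ y
  inj x∈ y∈ eq = ≡.trans (≡.sym (invol x∈)) (≡.trans (≡.cong f eq) (invol y∈))
  to : ∀ {z} → z ∈ List.map f xs → z ∈ xs
  to z∈ with x , x∈ , ≡.refl ← ∈-map⁻ f z∈ = closed x∈
  from : ∀ {z} → z ∈ xs → z ∈ List.map f xs
  from z∈ = ≡.subst (_∈ List.map f xs) (invol z∈) (∈-map⁺ f (closed z∈))

allFin-suc : ∀ n → allFin (suc n) ≡ zero ∷ List.map suc (allFin n)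
allFin-suc n = ≡.cong (zero ∷_) (≡.sym (List.map-tabulate id suc))

∈-tuples⁺ : {xs : List A} {v : Vec A m} → All (_∈ xs) v → v ∈ tuples xs m
∈-tuples⁺ []       = here ≡.refl
∈-tuples⁺ (p ∷ ps) = ∈-cartesianProductWith⁺ _∷_ p (∈-tuples⁺ ps)

∈-tuples⁻ : {xs : List A} → ∀ m {v} → v ∈ tuples xs m → All (_∈ xs) v
∈-tuples⁻ zero (here ≡.refl) = []
∈-tuples⁻ {xs = xs} (suc m) v∈
  with _ , _ , p , q , ≡.refl ← ∈-cartesianProductWith⁻ _∷_ xs (tuples xs m) v∈ = p ∷ ∈-tuples⁻ m q

unique-tuples : {xs : List A} → ListUnique.Unique xs → ∀ m → ListUnique.Unique (tuples xs m)
unique-tuples xs! zero    = [] ∷ []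
unique-tuples xs! (suc m) =
  ListUnique.cartesianProductWith⁺ _∷_ Vec.∷-injective xs! (unique-tuples xs! m)

∈-𝔖⁺ : {σ : Vec (Fin n) n} → Unique σ → σ ∈ 𝔖 n
∈-𝔖⁺ {σ = σ} = ∈-filter⁺ unique? (∈-tuples⁺ (All.universal ∈-allFin σ))

∈-𝔖⁻ : {σ : Vec (Fin n) n} → σ ∈ 𝔖 n → Unique σ
∈-𝔖⁻ {n} = proj₂ ∘ ∈-filter⁻ unique? {xs = tuples (allFin n) n}

unique-𝔖 : ∀ n → ListUnique.Unique (𝔖 n)
unique-𝔖 n = ListUnique.filter⁺ unique? (unique-tuples (ListUnique.allFin⁺ n) n)

-- If `j` were missed, removing it from the codomain would send `suc n` elements injectively into
-- `n`, against the pigeonhole principle.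
injective⇒surjective : (f : Fin n → Fin n) → Injective _≡_ _≡_ f → ∀ j → ∃ λ i → f i ≡ j
injective⇒surjective {suc n} f inj j with Fin.any? (λ i → f i Fin.≟ j)
... | yes hit = hit
... | no  j∉f with i , i′ , i<i′ , eq ← Fin.pigeonhole (ℕ.n<1+n n) (λ i → punchOut (λ j≡fi → j∉f (i , ≡.sym j≡fi))) =
  contradiction (inj (Fin.punchOut-injective (λ j≡fi → j∉f (i , ≡.sym j≡fi)) (λ j≡fi → j∉f (i′ , ≡.sym j≡fi)) eq)) (Fin.<⇒≢ i<i′)

lookup-↭-allFin : {σ : Vec (Fin n) n} → Unique σ → List.map (lookup σ) (allFin n) ↭ allFin n
lookup-↭-allFin {n} {σ} σ! =
  unique∧set⇒↭ (ListUnique.map⁺ (λ {i} {j} → Unique.lookup-injective σ! i j) (ListUnique.allFin⁺ n))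
    (ListUnique.allFin⁺ n) (λ {z} _ → ∈-allFin z) onto
  where
  onto : ∀ {z} → z ∈ allFin n → z ∈ List.map (lookup σ) (allFin n)
  onto {z} _ with i , ≡.refl ← injective⇒surjective (lookup σ) (λ {i} {j} → Unique.lookup-injective σ! i j) z =
    ∈-map⁺ (lookup σ) (∈-allFin i)

map-injective : {f : A → B} → Injective _≡_ _≡_ f → {v w : Vec A m} → Vec.map f v ≡ Vec.map f w → v ≡ w
map-injective inj {[]}    {[]}    _  = ≡.refl
map-injective inj {_ ∷ _} {_ ∷ _} eq = ≡.cong₂ _∷_ (inj (Vec.∷-injectiveˡ eq)) (map-injective inj (Vec.∷-injectiveʳ eq))

-- A permutation of n+1 symbols is a first value `i` followed by a permutation of n symbols,
-- relabelled so as to skip `i`. Counting such pairs gives the recursion of the factorial.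
extend : Fin (suc n) × Vec (Fin n) m → Vec (Fin (suc n)) (suc m)
extend (i , σ) = i ∷ Vec.map (punchIn i) σ

extend-injective : ∀ {p q : Fin (suc n) × Vec (Fin n) m} → extend p ≡ extend q → p ≡ q
extend-injective {p = i , σ} {j , τ} eq with ≡.refl ← Vec.∷-injectiveˡ eq =
  ≡.cong (i ,_) (map-injective (Fin.punchIn-injective i _ _) (Vec.∷-injectiveʳ eq))

unextend : {i : Fin (suc n)} {w : Vec (Fin (suc n)) m} → All (i ≢_) w → Unique w →
           ∃ λ u → Unique u × w ≡ Vec.map (punchIn i) u
unextend []         []       = [] , [] , ≡.refl
unextend {i = i} (i≢j ∷ i∉w) (j∉w ∷ w!) with u , u! , ≡.refl ← unextend i∉w w! =
  punchOut i≢j ∷ u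
  , All.map (λ j≢ → j≢ ∘ λ eq → ≡.trans (≡.sym (Fin.punchIn-punchOut i≢j)) (≡.cong (punchIn i) eq)) (All.map⁻ j∉w) ∷ u!
  , ≡.cong (_∷ _) (≡.sym (Fin.punchIn-punchOut i≢j))

length-cartesianProduct : (xs : List A) (ys : List B) →
                          length (cartesianProduct xs ys) ≡ length xs ℕ.* length ys
length-cartesianProduct []       ys = ≡.refl
length-cartesianProduct (x ∷ xs) ys =
  ≡.trans (List.length-++ (List.map (x ,_) ys))
        (≡.cong₂ ℕ._+_ (List.length-map (x ,_) ys) (length-cartesianProduct xs ys))

-- Needed to cancel the factor 1/n! of the hyperdeterminant, since every choice of the first
-- permutation will contribute the same amount.
length-𝔖 : ∀ n → length (𝔖 n) ≡ n !
length-𝔖 zero    = ≡.refl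
length-𝔖 (suc n) = begin
  length (𝔖 (suc n))                            ≡⟨ ↭-length 𝔖↭ ⟩
  length (List.map extend pairs)                ≡⟨ List.length-map extend pairs ⟩
  length pairs                                  ≡⟨ length-cartesianProduct (allFin (suc n)) (𝔖 n) ⟩
  length (allFin (suc n)) ℕ.* length (𝔖 n)        ≡⟨ ≡.cong₂ ℕ._*_ (List.length-tabulate {n = suc n} id) (length-𝔖 n) ⟩
  suc n ℕ.* n !                                   ∎
  where
  open ≡.≡-Reasoning
  pairs = cartesianProduct (allFin (suc n)) (𝔖 n)
  to : ∀ {σ} → σ ∈ 𝔖 (suc n) → σ ∈ List.map extend pairs
  to {i ∷ w} σ∈ with i∉w ∷ w! ← ∈-𝔖⁻ σ∈ with u , u! , ≡.refl ← unextend i∉w w! =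
    ∈-map⁺ extend (∈-cartesianProduct⁺ (∈-allFin i) (∈-𝔖⁺ u!))
  from : ∀ {σ} → σ ∈ List.map extend pairs → σ ∈ 𝔖 (suc n)
  from σ∈ with (i , u) , p∈ , ≡.refl ← ∈-map⁻ extend σ∈ =
    ∈-𝔖⁺ (All.map⁺ (All.universal (λ j → Fin.punchInᵢ≢i i j ∘ ≡.sym) u)
      ∷ Unique.map⁺ (Fin.punchIn-injective i _ _) (∈-𝔖⁻ (proj₂ (∈-cartesianProduct⁻ (allFin (suc n)) (𝔖 n) p∈))))
  𝔖↭ : 𝔖 (suc n) ↭ List.map extend pairs
  𝔖↭ = unique∧set⇒↭ (unique-𝔖 (suc n))
    (ListUnique.map⁺ extend-injective (ListUnique.cartesianProduct⁺ (ListUnique.allFin⁺ (suc n)) (unique-𝔖 n))) to from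

-- Adjacent transpositions

data Adjacent : ℕ → Set where
  here  : Adjacent (suc (suc n))
  there : Adjacent n → Adjacent (suc n)

swapAt : Adjacent m → Vec A m → Vec A m
swapAt here      (x ∷ y ∷ v) = y ∷ x ∷ v
swapAt (there i) (x ∷ v)     = x ∷ swapAt i v

swapAt-involutive : ∀ i (v : Vec A m) → swapAt i (swapAt i v) ≡ v
swapAt-involutive here      (x ∷ y ∷ v) = ≡.refl
swapAt-involutive (there i) (x ∷ v)     = ≡.cong (x ∷_) (swapAt-involutive i v)

swapAt-All : ∀ {P : A → Set o} i {v : Vec A m} → All P v → All P (swapAt i v)
swapAt-All here      (p ∷ q ∷ ps) = q ∷ p ∷ ps
swapAt-All (there i) (p ∷ ps)     = p ∷ swapAt-All i ps

swapAt-unique : ∀ i {v : Vec A m} → Unique v → Unique (swapAt i v)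
swapAt-unique here      ((x≢y ∷ x∉v) ∷ y∉v ∷ v!) = (x≢y ∘ ≡.sym ∷ y∉v) ∷ x∉v ∷ v!
swapAt-unique (there i) (x∉v ∷ v!)               = swapAt-All i x∉v ∷ swapAt-unique i v!

-- Adjacent swaps turn a vector with a repeated entry into one with two equal adjacent entries.
¬unique-induction : ∀ m (P : Vec (Fin n) m → Set o) →
                    (∀ i v → P (swapAt i v) → P v) → (∀ i v → swapAt i v ≡ v → P v) →
                    ∀ v → ¬ Unique v → P v
¬unique-induction zero          P swap fixed []       ¬v! = contradiction [] ¬v!
¬unique-induction (suc zero)    P swap fixed (x ∷ []) ¬v! = contradiction ([] ∷ []) ¬v!
¬unique-induction (suc (suc m)) P swap fixed (x ∷ y ∷ v) ¬v! =
  -- If `y ∷ v` has no repetition, then `x` occurs again. Either `x` equals `y`, or swapping the two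
  -- leaves the tail `x ∷ v`, which does have a repetition.
  [ (λ yv! → [ (λ x≡y → fixed here (x ∷ y ∷ v) (≡.cong₂ (λ a b → b ∷ a ∷ v) x≡y (≡.sym x≡y)))
             , (λ x≢y → swap here (x ∷ y ∷ v) (¬unique-induction (suc m) (P ∘ (y ∷_))
                 (λ i v → swap (there i) (y ∷ v)) (λ i v → fixed (there i) (y ∷ v) ∘ ≡.cong (y ∷_)) (x ∷ v)
                 λ { (x∉v ∷ _) → ¬v! ((x≢y ∷ x∉v) ∷ yv!) }))
             ]′ (toSum (x Fin.≟ y)))
  , (¬unique-induction (suc m) (P ∘ (x ∷_)) (λ i v → swap (there i) (x ∷ v))
      (λ i v → fixed (there i) (x ∷ v) ∘ ≡.cong (x ∷_)) (y ∷ v))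
  ]′ (toSum (unique? (y ∷ v)))

-- Lists of divisors

∈-divisors⁺ : ∀ {d r} → .{{NonZero d}} → .{{NonZero r}} → d ∣ r → d ∈ divisors r
∈-divisors⁺ {suc d} {r} d∣r =
  ∈-filter⁺ (_∣? r) (∈-map⁺ suc (∈-upTo⁺ (∣⇒≤ d∣r))) d∣r

∈-divisors⁻ : ∀ {d} r → d ∈ divisors r → NonZero d × d ∣ r
∈-divisors⁻ r d∈ with d∈′ , d∣r ← ∈-filter⁻ (_∣? r) {xs = List.map suc (upTo r)} d∈
  with _ , _ , ≡.refl ← ∈-map⁻ suc d∈′ = _ , d∣r

unique-divisors : ∀ r → ListUnique.Unique (divisors r)
unique-divisors r = ListUnique.filter⁺ (_∣? r) (ListUnique.map⁺ ℕ.suc-injective (ListUnique.upTo⁺ r))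

-- The inclusion `from` is where factor-closedness enters the proof: it lets a sum over the divisors
-- of `x i` be written as a sum over indices.
factorClosed⇒divisors-↭ : (x : Fin n → ℕ) (x≢0 : ∀ v → NonZero (x v)) → Injective _≡_ _≡_ x →
  FactorClosed (λ m → ∃ λ v → x v ≡ m) →
  ∀ i → List.map x (List.filter (λ e → x e ∣? x i) (allFin n)) ↭ divisors (x i)
factorClosed⇒divisors-↭ {n} x x≢0 inj closed i =
  unique∧set⇒↭ (ListUnique.map⁺ inj (ListUnique.filter⁺ P? (ListUnique.allFin⁺ n))) (unique-divisors (x i)) to from
  where
  P? = λ e → x e ∣? x i
  to : ∀ {d} → d ∈ List.map x (List.filter P? (allFin n)) → d ∈ divisors (x i)
  to d∈ with e , e∈ , ≡.refl ← ∈-map⁻ x d∈ =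
    ∈-divisors⁺ {{x≢0 e}} {{x≢0 i}} (proj₂ (∈-filter⁻ P? {xs = allFin n} e∈))
  from : ∀ {d} → d ∈ divisors (x i) → d ∈ List.map x (List.filter P? (allFin n))
  from d∈ with d≢0 , d∣ ← ∈-divisors⁻ (x i) d∈ with e , ≡.refl ← closed (i , ≡.refl) d≢0 d∣ =
    ∈-map⁺ x (∈-filter⁺ P? (∈-allFin e) d∣)

-- Finite sums and products

module BigOperator {c ℓ} (M : CommutativeMonoid c ℓ) where
  open CommutativeMonoid M renaming (refl to ≈-refl; sym to ≈-sym; trans to ≈-trans)
  open import Relation.Binary.Reasoning.Setoid setoid
  open import Algebra.Properties.CommutativeSemigroup commutativeSemigroup using (interchange; x∙yz≈y∙xz)

  ⨁ : List A → (A → Carrier) → Carrier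
  ⨁ xs f = List.foldr (λ x s → f x ∙ s) ε xs

  cong-∈ : (xs : List A) {f g : A → Carrier} → (∀ x → x ∈ xs → f x ≈ g x) → ⨁ xs f ≈ ⨁ xs g
  cong-∈ []       f≈g = ≈-refl
  cong-∈ (x ∷ xs) f≈g = ∙-cong (f≈g x (here ≡.refl)) (cong-∈ xs (λ y → f≈g y ∘ there))

  ⨁-cong : (xs : List A) {f g : A → Carrier} → (∀ x → f x ≈ g x) → ⨁ xs f ≈ ⨁ xs g
  ⨁-cong xs f≈g = cong-∈ xs (λ x _ → f≈g x)

  ⨁-ε : (xs : List A) {f : A → Carrier} → (∀ x → x ∈ xs → f x ≈ ε) → ⨁ xs f ≈ ε
  ⨁-ε []       f≈ε = ≈-refl
  ⨁-ε (x ∷ xs) f≈ε = ≈-trans (∙-cong (f≈ε x (here ≡.refl)) (⨁-ε xs (λ y → f≈ε y ∘ there))) (identityˡ ε)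

  ⨁-map : (h : A → B) (xs : List A) {f : B → Carrier} → ⨁ (List.map h xs) f ≈ ⨁ xs (f ∘ h)
  ⨁-map h []       = ≈-refl
  ⨁-map h (x ∷ xs) = ∙-congˡ (⨁-map h xs)

  ⨁-++ : (xs ys : List A) {f : A → Carrier} → ⨁ (xs ++ ys) f ≈ ⨁ xs f ∙ ⨁ ys f
  ⨁-++ []       ys = ≈-sym (identityˡ _)
  ⨁-++ (x ∷ xs) ys = ≈-trans (∙-congˡ (⨁-++ xs ys)) (≈-sym (assoc _ _ _))

  ⨁-↭ : {xs ys : List A} {f : A → Carrier} → xs ↭ ys → ⨁ xs f ≈ ⨁ ys f
  ⨁-↭ ↭.refl       = ≈-refl
  ⨁-↭ (↭.prep x p) = ∙-congˡ (⨁-↭ p)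
  ⨁-↭ (↭.swap x y p)= ≈-trans (∙-congˡ (∙-congˡ (⨁-↭ p))) (x∙yz≈y∙xz _ _ _)
  ⨁-↭ (↭.trans p q) = ≈-trans (⨁-↭ p) (⨁-↭ q)

  ⨁-reindex : {h : A → B} {xs : List A} {ys : List B} {f : B → Carrier} →
              List.map h xs ↭ ys → ⨁ xs (f ∘ h) ≈ ⨁ ys f
  ⨁-reindex {h = h} {xs} p = ≈-trans (≈-sym (⨁-map h xs)) (⨁-↭ p)

  ⨁-∙ : (xs : List A) {f g : A → Carrier} → ⨁ xs (λ x → f x ∙ g x) ≈ ⨁ xs f ∙ ⨁ xs g
  ⨁-∙ []       = ≈-sym (identityˡ ε)
  ⨁-∙ (x ∷ xs) = ≈-trans (∙-congˡ (⨁-∙ xs)) (interchange _ _ _ _)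

  ⨁-swap : (xs : List A) (ys : List B) {f : A → B → Carrier} →
           ⨁ xs (λ x → ⨁ ys (f x)) ≈ ⨁ ys (λ y → ⨁ xs (λ x → f x y))
  ⨁-swap []       ys = ≈-sym (⨁-ε ys (λ _ _ → ≈-refl))
  ⨁-swap (x ∷ xs) ys = ≈-trans (∙-congˡ (⨁-swap xs ys)) (≈-sym (⨁-∙ ys))

  ⨁-product : (h : A → B → C) (xs : List A) (ys : List B) {f : C → Carrier} →
              ⨁ (cartesianProductWith h xs ys) f ≈ ⨁ xs (λ x → ⨁ ys (λ y → f (h x y)))
  ⨁-product h []       ys = ≈-refl
  ⨁-product h (x ∷ xs) ys =
    ≈-trans (⨁-++ (List.map (h x) ys) _) (∙-cong (⨁-map (h x) ys) (⨁-product h xs ys))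

  ⨁-filter : {P : Pred A o} (P? : Decidable P) (xs : List A) {f : A → Carrier} →
             (∀ x → ¬ P x → f x ≈ ε) → ⨁ (List.filter P? xs) f ≈ ⨁ xs f
  ⨁-filter P? []       f≈ε = ≈-refl
  ⨁-filter P? (x ∷ xs) f≈ε with P? x
  ... | yes _  = ∙-congˡ (⨁-filter P? xs f≈ε)
  ... | no ¬px = ≈-trans (⨁-filter P? xs f≈ε) (≈-sym (≈-trans (∙-congʳ (f≈ε x ¬px)) (identityˡ _)))

  ⨁-single : {xs : List A} {f : A → Carrier} → ListUnique.Unique xs → ∀ {s} → s ∈ xs →
             (∀ x → x ∈ xs → x ≢ s → f x ≈ ε) → ⨁ xs f ≈ f s
  ⨁-single (s∉ ∷ xs!) (here ≡.refl) f≈ε =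
    ≈-trans (∙-congˡ (⨁-ε _ (λ y y∈ → f≈ε y (there y∈) (ListAll.lookup s∉ y∈ ∘ ≡.sym)))) (identityʳ _)
  ⨁-single (x∉ ∷ xs!) (there s∈) f≈ε =
    ≈-trans (∙-cong (f≈ε _ (here ≡.refl) (ListAll.lookup x∉ s∈)) (⨁-single xs! s∈ (λ y → f≈ε y ∘ there)))
      (identityˡ _)

  ⨁-allFin-suc : ∀ n {f : Fin (suc n) → Carrier} →
                 ⨁ (allFin (suc n)) f ≈ f zero ∙ ⨁ (allFin n) (f ∘ suc)
  ⨁-allFin-suc n {f} = ≈-trans (reflexive (≡.cong (λ xs → ⨁ xs f) (allFin-suc n)))
    (∙-congˡ (⨁-map suc (allFin n)))

  -- Both vectors are swapped at the same place, so the same pairs of entries occur in another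
  -- order.
  ⨁-swapAt : ∀ i (v : Vec A m) (w : Vec B m) {h : A → B → Carrier} →
    ⨁ (allFin m) (λ j → h (lookup (swapAt i v) j) (lookup (swapAt i w) j)) ≈
    ⨁ (allFin m) (λ j → h (lookup v j) (lookup w j))
  ⨁-swapAt {m = suc (suc m)} here (x ∷ y ∷ v) (x′ ∷ y′ ∷ w) {h} = begin
    _                                    ≈⟨ two y x v y′ x′ w ⟩
    h y y′ ∙ (h x x′ ∙ ⨁ (allFin m) _)   ≈⟨ x∙yz≈y∙xz _ _ _ ⟩
    h x x′ ∙ (h y y′ ∙ ⨁ (allFin m) _)   ≈⟨ two x y v x′ y′ w ⟨
    _                                    ∎
    where
    two : ∀ x y v x′ y′ w →
      ⨁ (allFin (suc (suc m))) (λ j → h (lookup (x ∷ y ∷ v) j) (lookup (x′ ∷ y′ ∷ w) j)) ≈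
      h x x′ ∙ (h y y′ ∙ ⨁ (allFin m) (λ j → h (lookup v j) (lookup w j)))
    two x y v x′ y′ w = ≈-trans (⨁-allFin-suc (suc m)) (∙-congˡ (⨁-allFin-suc m))
  ⨁-swapAt {m = suc m} (there i) (x ∷ v) (y ∷ w) {h} =
    ≈-trans (⨁-allFin-suc m) (≈-trans (∙-congˡ (⨁-swapAt i v w {h})) (≈-sym (⨁-allFin-suc m)))

-- Divisibility

prime∧∤⇒coprime : Prime p → ¬ p ∣ c → Coprime c p
prime∧∤⇒coprime p-prime p∤c (i∣c , i∣p) with prime⇒irreducible p-prime i∣p
... | inj₁ i≡1  = i≡1
... | inj₂ ≡.refl = contradiction i∣c p∤c

recompute-nonZero : ∀ n → .{{NonZero n}} → NonZero n
recompute-nonZero (suc _) = _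

*-nonZeroˡ : ∀ c → NonZero (c ℕ.* e) → NonZero c
*-nonZeroˡ (suc c) _ = _

*-nonZeroʳ : ∀ c → NonZero (c ℕ.* e) → NonZero e
*-nonZeroʳ {zero}  c nz = contradiction (ℕ.*-zeroʳ c) (≢-nonZero⁻¹ (c ℕ.* 0) {{nz}})
*-nonZeroʳ {suc e} c nz = _

-- Write d = m gcd(d,r). An empty factorisation would mean m = 1 and hence d ∣ r, so m has a prime
-- factor, and any such `p` will do.
∤⇒∃prime : .{{NonZero d}} → ¬ d ∣ r → ∃ λ p → Prime p × p ℕ.* gcd d r ∣ d
∤⇒∃prime {d} {r} d∤r with gcd[m,n]∣m d r
... | divides m d≡m*g with factorise m {{m≢0}}
  where
  m≢0 : NonZero m
  m≢0 = *-nonZeroˡ m (≡.subst NonZero d≡m*g (recompute-nonZero d))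
... | record { factors = [] ; isFactorisation = ≡.refl } =
  contradiction (≡.subst (_∣ r) (≡.sym (≡.trans d≡m*g (ℕ.*-identityˡ _))) (gcd[m,n]∣n d r)) d∤r
... | record { factors = p ∷ ps ; isFactorisation = m≡ ; factorsPrime = p-prime ∷ _ } =
  p , p-prime , ≡.subst (p ℕ.* gcd d r ∣_) (≡.sym d≡m*g)
    (*-monoˡ-∣ (gcd d r) (≡.subst (p ∣_) (≡.sym m≡) (m∣m*n (product ps))))

-- Let q = gcd(pe,r). Then q divides both d and r, so pq divides p gcd(d,r) and hence d = p(ce),
-- which gives q ∣ ce. Together with q ∣ pe and the coprimality of c and p this yields q ∣ e.
gcd-cancel-prime : Prime p → ¬ p ∣ c → d ≡ c ℕ.* (p ℕ.* e) → p ℕ.* gcd d r ∣ d → gcd (p ℕ.* e) r ≡ gcd e r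
gcd-cancel-prime {p} {c} {d} {e} {r} p-prime p∤c d≡ pg∣d =
  ∣-antisym (gcd-greatest q∣e q∣r)
    (gcd-greatest (∣n⇒∣m*n p (gcd[m,n]∣m e r)) (gcd[m,n]∣n e r))
  where
  instance _ = prime⇒nonZero p-prime
  q = gcd (p ℕ.* e) r
  q∣r : q ∣ r
  q∣r = gcd[m,n]∣n (p ℕ.* e) r
  q∣pe : q ∣ p ℕ.* e
  q∣pe = gcd[m,n]∣m (p ℕ.* e) r
  q∣g : q ∣ gcd d r
  q∣g = gcd-greatest (≡.subst (q ∣_) (≡.sym d≡) (∣n⇒∣m*n c q∣pe)) q∣r
  d≡p*ce : d ≡ p ℕ.* (c ℕ.* e)
  d≡p*ce = ≡.trans d≡ (≡.trans (≡.sym (ℕ.*-assoc c p e)) (≡.trans (≡.cong (ℕ._* e) (ℕ.*-comm c p)) (ℕ.*-assoc p c e)))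
  q∣ce : q ∣ c ℕ.* e
  q∣ce = *-cancelˡ-∣ p (≡.subst (p ℕ.* q ∣_) d≡p*ce (∣-trans (*-monoʳ-∣ p q∣g) pg∣d))
  q∣e : q ∣ e
  q∣e = coprime-factors (prime∧∤⇒coprime p-prime p∤c) (q∣ce , q∣pe)

-- Multiplication by p pairs off the numbers divisible by p at most once;
-- the Möbius function changes sign along a pair and vanishes at the remaining numbers.
data Toggle (p c c′ : ℕ) : Set where
  up   : ¬ p ∣ c  → c′ ≡ p ℕ.* c → Toggle p c c′
  down : ¬ p ∣ c′ → c ≡ p ℕ.* c′ → Toggle p c c′
  stay : p ℕ.* p ∣ c → c ≡ c′ → Toggle p c c′

toggle : ∀ p c → ∃ (Toggle p c)
toggle p c with p ∣? c
... | no p∤c = p ℕ.* c , up p∤c ≡.refl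
... | yes (divides c′ c≡) with p ∣? c′
...   | no p∤c′  = c′ , down p∤c′ (≡.trans c≡ (ℕ.*-comm c′ p))
...   | yes p∣c′ = c , stay (≡.subst (p ℕ.* p ∣_) (≡.sym c≡) (*-monoˡ-∣ p p∣c′)) ≡.refl

toggle-sym : Toggle p c c′ → Toggle p c′ c
toggle-sym (up p∤c eq)    = down p∤c eq
toggle-sym (down p∤c′ eq) = up p∤c′ eq
toggle-sym (stay pp∣c ≡.refl) = stay pp∣c ≡.refl

-- The constructors exclude one another: `p` divides `c` not at all, exactly once, or at least
-- twice. With `toggle-sym` this makes `toggle` an involution.
toggle-unique : .{{NonZero p}} → Toggle p c d → Toggle p c e → d ≡ e
toggle-unique (up _ ≡.refl)         (up _ ≡.refl)       = ≡.refl
toggle-unique {p} (up p∤c _)      (down _ ≡.refl)     = contradiction (m∣m*n _) p∤c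
toggle-unique {p} (up p∤c _)      (stay pp∣c _)     = contradiction (m*n∣⇒m∣ p p pp∣c) p∤c
toggle-unique (down _ ≡.refl)       (up p∤c _)        = contradiction (m∣m*n _) p∤c
toggle-unique {p} (down _ ≡.refl)   (down _ eq)       = ℕ.*-cancelˡ-≡ _ _ p eq
toggle-unique {p} (down p∤d ≡.refl) (stay pp∣c _)     = contradiction (*-cancelˡ-∣ p pp∣c) p∤d
toggle-unique {p} (stay pp∣c _)   (up p∤c _)        = contradiction (m*n∣⇒m∣ p p pp∣c) p∤c
toggle-unique {p} (stay pp∣c _)   (down p∤e ≡.refl)   = contradiction (*-cancelˡ-∣ p pp∣c) p∤e
toggle-unique (stay _ ≡.refl)       (stay _ ≡.refl)     = ≡.refl

-- Only `up` needs an argument: if d = ec with p ∣ d and p ∤ c, then Euclid's lemma gives p ∣ e, so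
-- pc still divides d.
toggle-∣ : Prime p → p ∣ d → Toggle p c c′ → c ∣ d → c′ ∣ d
toggle-∣ {p} {c = c} p-prime p∣d (up p∤c ≡.refl) (divides e ≡.refl)
  with euclidsLemma e c p-prime p∣d
... | inj₁ p∣e = *-monoˡ-∣ c p∣e
... | inj₂ p∣c = contradiction p∣c p∤c
toggle-∣ {p} p-prime p∣d (down _ ≡.refl) c∣d = m*n∣⇒n∣ p _ c∣d
toggle-∣ p-prime p∣d (stay _ ≡.refl) c∣d = c∣d

div-*ʳ : ∀ m n → .{{NonZero n}} → (m ℕ.* n) div n ≡ m
div-*ʳ m (suc n) = m*n/n≡m m (suc n)

div-*-cancel : .{{NonZero c}} → c ∣ d → (d div c) ℕ.* c ≡ d
div-*-cancel {suc c} c∣d = m/n*n≡m c∣d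

div-involutive : .{{NonZero c}} → .{{NonZero d}} → c ∣ d → d div (d div c) ≡ c
div-involutive {c} c∣d@(divides e ≡.refl) =
  ≡.trans (≡.cong ((e ℕ.* c) div_) (div-*ʳ e c)) (≡.trans (≡.cong (_div e) (ℕ.*-comm e c)) (div-*ʳ c e {{e≢0}}))
  where
  .e≢0 : NonZero e
  e≢0 = quotient≢0 c∣d

toggle-nonZero : .{{NonZero p}} → Toggle p c c′ → NonZero c → NonZero c′
toggle-nonZero {p} {c} (up _ ≡.refl)  c≢0 = ℕ.m*n≢0 p c {{it}} {{c≢0}}
toggle-nonZero {p}     (down _ ≡.refl) c≢0 = *-nonZeroʳ p c≢0
toggle-nonZero         (stay _ ≡.refl) c≢0 = c≢0

∤⇒∣suc : ∀ {k} → ¬ 2 ∣ k → 2 ∣ suc k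
∤⇒∣suc {zero}        2∤0 = contradiction (2 ∣0) 2∤0
∤⇒∣suc {suc zero}    _   = ∣-refl
∤⇒∣suc {suc (suc k)} 2∤k = ∣m∣n⇒∣m+n ∣-refl (∤⇒∣suc (2∤k ∘ ∣m∣n⇒∣m+n ∣-refl))

unique-resp-↭ : ∀ {a} {A : Set a} {xs ys : List A} → xs ↭ ys → ListUnique.Unique xs → ListUnique.Unique ys
unique-resp-↭ {A = A} p = Permutation.Unique-resp-↭ (≡.setoid A) (↭⇒↭ₛ p)

prime-∷ : ∀ {p c} → Prime p → PrimeFactorisation c → PrimeFactorisation (p ℕ.* c)
prime-∷ {p} p-prime f = record
  { factors         = p ∷ PrimeFactorisation.factors f
  ; isFactorisation = ≡.cong (p ℕ.*_) (PrimeFactorisation.isFactorisation f)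
  ; factorsPrime    = p-prime ListAll.∷ PrimeFactorisation.factorsPrime f
  }

-- Entrywise comparison through sums of natural numbers

module ℕSum = BigOperator ℕ.+-0-commutativeMonoid

-- A strict inequality at one entry could not be compensated at another.
sum-≤-≡ : (xs : List A) {f g : A → ℕ} → (∀ x → f x ≤ g x) →
          ℕSum.⨁ xs f ≡ ℕSum.⨁ xs g → ∀ {x} → x ∈ xs → f x ≡ g x
sum-≤-≡ {A = A} (y ∷ xs) {f} {g} f≤g Σf≡Σg = λ
  { (here ≡.refl) → fy≡gy
  ; (there x∈)    → sum-≤-≡ xs f≤g
      (ℕ.+-cancelˡ-≡ (f y) _ _ (≡.trans Σf≡Σg (≡.cong (ℕ._+ ℕSum.⨁ xs g) (≡.sym fy≡gy)))) x∈ }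
  where
  sum-mono : (xs : List A) → ℕSum.⨁ xs f ≤ ℕSum.⨁ xs g
  sum-mono []       = ℕ.z≤n
  sum-mono (x ∷ xs) = ℕ.+-mono-≤ (f≤g x) (sum-mono xs)
  fy≡gy : f y ≡ g y
  fy≡gy = ℕ.≤-antisym (f≤g y) (ℕ.+-cancelʳ-≤ (ℕSum.⨁ xs g) _ _
    (ℕ.≤-trans (ℕ.≤-reflexive (≡.sym Σf≡Σg)) (ℕ.+-monoʳ-≤ (f y) (sum-mono xs))))

lookup-extensional : {v w : Vec A m} → (∀ i → lookup v i ≡ lookup w i) → v ≡ w
lookup-extensional {v = v} {w} eq =
  ≡.trans (≡.sym (Vec.tabulate∘lookup v)) (≡.trans (Vec.tabulate-cong eq) (Vec.tabulate∘lookup w))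

All-replicate : ∀ {p} {P : A → Set p} {x} k → P x → All P (replicate k x)
All-replicate zero    px = []
All-replicate (suc k) px = px ∷ All-replicate k px

-- The values of x at the entries of σ and τ have the same sum, so entrywise divisibility is entrywise equality.
divides-pointwise⇒≡ : (x : Fin n → ℕ) → (∀ v → NonZero (x v)) → Injective _≡_ _≡_ x →
  {σ τ : Vec (Fin n) n} → Unique σ → Unique τ → (∀ v → x (lookup τ v) ∣ x (lookup σ v)) → τ ≡ σ
divides-pointwise⇒≡ {n} x x≢0 inj σ! τ! τ∣σ = lookup-extensional λ v → inj
  (sum-≤-≡ (allFin n) (λ v → ∣⇒≤ {{x≢0 _}} (τ∣σ v))
    (≡.trans (ℕSum.⨁-reindex {f = x} (lookup-↭-allFin τ!)) (≡.sym (ℕSum.⨁-reindex {f = x} (lookup-↭-allFin σ!))))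
    (∈-allFin v))

-- Hyperdeterminants

module Hyperdeterminant {c ℓ} (R : CommutativeℚAlgebra c ℓ) where
  open CommutativeℚAlgebra R hiding (zero; _×_)
  open Arithmetic R
  open import Relation.Binary.Reasoning.Setoid setoid
  open import Algebra.Properties.Ring ring using (-1*x≈-x; -‿distribˡ-*; -‿distribʳ-*; -‿involutive; -0#≈0#)
  open import Algebra.Properties.CommutativeSemigroup *-commutativeSemigroup
    using (interchange; x∙yz≈y∙xz)
  open import Algebra.Properties.CommutativeSemiring.Exp commutativeSemiring using (^-distrib-*; ^-congˡ)
  module Sum = BigOperator +-commutativeMonoid
  module Product = BigOperator *-commutativeMonoid

  sum-*ˡ : ∀ a (xs : List A) {f : A → Carrier} → ∑[ x ∈ xs ] (a * f x) ≈ a * (∑[ x ∈ xs ] f x)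
  sum-*ˡ a []       = sym (zeroʳ a)
  sum-*ˡ a (x ∷ xs) = trans (+-congˡ (sum-*ˡ a xs)) (sym (distribˡ a _ _))

  sum-*ʳ : ∀ a (xs : List A) {f : A → Carrier} → ∑[ x ∈ xs ] (f x * a) ≈ (∑[ x ∈ xs ] f x) * a
  sum-*ʳ a xs = trans (Sum.⨁-cong xs (λ x → *-comm _ a)) (trans (sum-*ˡ a xs) (*-comm a _))

  -- Generalised distributivity: `τ` picks one summand from each factor. The choices may coincide,
  -- so in `mobius-det` vectors that are not permutations arise and must be removed.
  prod-sum : ∀ m (xs : List A) {g : Fin m → A → Carrier} →
    (∏[ v ∈ allFin m ] (∑[ e ∈ xs ] g v e)) ≈ ∑[ τ ∈ tuples xs m ] (∏[ v ∈ allFin m ] g v (lookup τ v))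
  prod-sum zero    xs = sym (+-identityʳ 1#)
  prod-sum (suc m) xs {g} = begin
    (∏[ v ∈ allFin (suc m) ] (∑[ e ∈ xs ] g v e))
      ≈⟨ Product.⨁-allFin-suc m ⟩
    (∑[ e ∈ xs ] g zero e) * (∏[ v ∈ allFin m ] (∑[ e ∈ xs ] g (suc v) e))
      ≈⟨ *-congˡ (prod-sum m xs) ⟩
    (∑[ e ∈ xs ] g zero e) * (∑[ τ ∈ tuples xs m ] (∏[ v ∈ allFin m ] g (suc v) (lookup τ v)))
      ≈⟨ sum-*ʳ _ xs ⟨
    (∑[ e ∈ xs ] (g zero e * (∑[ τ ∈ tuples xs m ] (∏[ v ∈ allFin m ] g (suc v) (lookup τ v)))))
      ≈⟨ Sum.⨁-cong xs (λ e → trans (sym (sum-*ˡ _ (tuples xs m)))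
           (Sum.⨁-cong (tuples xs m) λ τ → sym (Product.⨁-allFin-suc m))) ⟩
    (∑[ e ∈ xs ] (∑[ τ ∈ tuples xs m ] (∏[ v ∈ allFin (suc m) ] g v (lookup (e ∷ τ) v))))
      ≈⟨ Sum.⨁-product _∷_ xs (tuples xs m) ⟨
    (∑[ τ ∈ tuples xs (suc m) ] (∏[ v ∈ allFin (suc m) ] g v (lookup τ v)))
      ∎

  prod-zero : {xs : List A} {f : A → Carrier} → ∀ {x} → x ∈ xs → f x ≈ 0# → (∏[ y ∈ xs ] f y) ≈ 0#
  prod-zero (Any.here ≡.refl) fx≈0 = trans (*-congʳ fx≈0) (zeroˡ _)
  prod-zero (Any.there x∈)  fx≈0 = trans (*-congˡ (prod-zero x∈ fx≈0)) (zeroʳ _)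

  -- Multiply 2x = 0 by the inverse of 2. Thus a sum that an involution sends to its negative
  -- vanishes, without a choice of one term from each pair.
  x≈-x⇒x≈0 : ∀ {x} → x ≈ - x → x ≈ 0#
  x≈-x⇒x≈0 {x} x≈-x = begin
    x                        ≈⟨ *-identityˡ x ⟨
    1# * x                   ≈⟨ *-congʳ (inverse 2) ⟨
    ι 2 * recip 2 * x        ≈⟨ trans (*-congʳ (*-comm _ _)) (*-assoc _ _ _) ⟩
    recip 2 * (ι 2 * x)      ≈⟨ *-congˡ (trans (*-congʳ (+-congˡ (+-identityʳ 1#))) (distribʳ x 1# 1#)) ⟩
    recip 2 * (1# * x + 1# * x)
      ≈⟨ *-congˡ (+-cong (*-identityˡ x) (trans (*-identityˡ x) x≈-x)) ⟩
    recip 2 * (x + - x)      ≈⟨ trans (*-congˡ (-‿inverseʳ x)) (zeroʳ _) ⟩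
    0#                       ∎

  sum-- : (xs : List A) {f : A → Carrier} → ∑[ x ∈ xs ] (- f x) ≈ - (∑[ x ∈ xs ] f x)
  sum-- xs = trans (Sum.⨁-cong xs (λ x → sym (-1*x≈-x _))) (trans (sum-*ˡ (- 1#) xs) (-1*x≈-x _))

  -- Signs of permutations

  signOf : Bool → Carrier
  signOf s = if s then - 1# else 1#

  ^-length-filter : ∀ {p} {P : Pred A p} (P? : Decidable P) (xs : List A) →
    (- 1#) ^ length (List.filter P? xs) ≈ ∏[ x ∈ xs ] signOf (does (P? x))
  ^-length-filter P? []       = refl
  ^-length-filter P? (x ∷ xs) with P? x
  ... | yes _ = *-congˡ (^-length-filter P? xs)
  ... | no _  = trans (^-length-filter P? xs) (sym (*-identityˡ _))

  sign : Fin N → Fin N → Carrier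
  sign x y = signOf (does (y Fin.<? x))

  signOf-exclusive : ∀ {p q} {P : Set p} {Q : Set q} (P? : Dec P) (Q? : Dec Q) →
    ¬ (P × Q) → ¬ (¬ P × ¬ Q) → signOf (does P?) ≈ - signOf (does Q?)
  signOf-exclusive (yes p) (yes q) ¬both _        = contradiction (p , q) ¬both
  signOf-exclusive (yes _) (no _)  _     _        = refl
  signOf-exclusive (no _)  (yes _) _     _        = sym (-‿involutive 1#)
  signOf-exclusive (no ¬p) (no ¬q) _     ¬neither = contradiction (¬p , ¬q) ¬neither

  sign-antisym : {x y : Fin N} → x ≢ y → sign y x ≈ - sign x y
  sign-antisym {x = x} {y} x≢y = signOf-exclusive (x Fin.<? y) (y Fin.<? x)
    (λ (x<y , y<x) → Fin.<-asym x<y y<x)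
    (λ (x≮y , y≮x) → x≢y (Fin.≤-antisym (ℕ.≮⇒≥ y≮x) (ℕ.≮⇒≥ x≮y)))

  signProduct : Vec (Fin N) m → Carrier
  signProduct []          = 1#
  signProduct {m = suc m} (x ∷ σ) = (∏[ j ∈ allFin m ] sign x (lookup σ j)) * signProduct σ

  sgn≈signProduct : (σ : Vec (Fin n) n) → sgn σ ≈ signProduct σ
  sgn≈signProduct {n} σ = begin
    (- 1#) ^ inversions σ
      ≈⟨ ^-length-filter (λ (i , j) → (i Fin.<? j) ×-dec (lookup σ j Fin.<? lookup σ i)) (cartesianProduct (allFin n) (allFin n)) ⟩
    (∏[ (i , j) ∈ cartesianProduct (allFin n) (allFin n) ] w σ i j)
      ≈⟨ Product.⨁-product _,_ (allFin n) (allFin n) ⟩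
    (∏[ i ∈ allFin n ] (∏[ j ∈ allFin n ] w σ i j))
      ≈⟨ recursion σ ⟩
    signProduct σ ∎
    where
    w : Vec (Fin N) m → Fin m → Fin m → Carrier
    w σ i j = signOf (does ((i Fin.<? j) ×-dec (lookup σ j Fin.<? lookup σ i)))
    recursion : (σ : Vec (Fin N) m) → (∏[ i ∈ allFin m ] (∏[ j ∈ allFin m ] w σ i j)) ≈ signProduct σ
    recursion []      = refl
    -- The factor at j = 0 is trivial in every row, because no i is below 0. What is left of row 0
    -- compares `x` with the later entries.
    recursion {m = suc m} (x ∷ σ) = trans (Product.⨁-allFin-suc m) (*-cong
      (trans (Product.⨁-allFin-suc m) (*-identityˡ _))
      (trans (Product.⨁-cong (allFin m) (λ i → trans (Product.⨁-allFin-suc m) (*-identityˡ _))) (recursion σ)))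

  -- Only the comparison of the two swapped entries with each other changes sign; all other
  -- comparisons are rearranged.
  signProduct-swapAt : ∀ i {σ : Vec (Fin N) m} → Unique σ → signProduct (swapAt i σ) ≈ - signProduct σ
  signProduct-swapAt {m = suc (suc m)} here {x ∷ y ∷ σ} ((x≢y ∷ _) ∷ _) = begin
    (∏[ j ∈ allFin (suc m) ] sign y (lookup (x ∷ σ) j)) * (X * S)
      ≈⟨ *-congʳ (Product.⨁-allFin-suc m) ⟩
    sign y x * Y * (X * S)
      ≈⟨ *-congʳ (*-congʳ (sign-antisym x≢y)) ⟩
    - sign x y * Y * (X * S)
      ≈⟨ interchange _ _ _ _ ⟩
    - sign x y * X * (Y * S)
      ≈⟨ trans (*-congʳ (sym (-‿distribˡ-* _ _))) (sym (-‿distribˡ-* _ _)) ⟩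
    - (sign x y * X * (Y * S))
      ≈⟨ -‿cong (*-congʳ (Product.⨁-allFin-suc m)) ⟨
    - ((∏[ j ∈ allFin (suc m) ] sign x (lookup (y ∷ σ) j)) * (Y * S)) ∎
    where
    X = ∏[ j ∈ allFin m ] sign x (lookup σ j)
    Y = ∏[ j ∈ allFin m ] sign y (lookup σ j)
    S = signProduct σ
  signProduct-swapAt (there i) {x ∷ σ} (_ ∷ σ!) =
    trans (*-cong (Product.⨁-swapAt i σ σ {λ y _ → sign x y}) (signProduct-swapAt i σ!)) (sym (-‿distribʳ-* _ _))

  sgn-swapAt : ∀ i {σ : Vec (Fin n) n} → Unique σ → sgn (swapAt i σ) ≈ - sgn σ
  sgn-swapAt i {σ} σ! = trans (sgn≈signProduct (swapAt i σ))
    (trans (signProduct-swapAt i σ!) (-‿cong (sym (sgn≈signProduct σ))))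

  1^n≈1 : ∀ n → 1# ^ n ≈ 1#
  1^n≈1 zero    = refl
  1^n≈1 (suc n) = trans (*-identityˡ _) (1^n≈1 n)

  prod-^ : (xs : List A) {f : A → Carrier} → ∀ k → ∏[ x ∈ xs ] (f x ^ k) ≈ (∏[ x ∈ xs ] f x) ^ k
  prod-^ []       k = sym (1^n≈1 k)
  prod-^ (x ∷ xs) k = trans (*-congˡ (prod-^ xs k)) (sym (^-distrib-* _ _ k))

  sgn*sgn≈1 : (σ : Vec (Fin n) n) → sgn σ * sgn σ ≈ 1#
  sgn*sgn≈1 σ = begin
    (- 1#) ^ l * (- 1#) ^ l   ≈⟨ ^-distrib-* (- 1#) (- 1#) l ⟨
    (- 1# * - 1#) ^ l         ≈⟨ ^-congˡ l (trans (-1*x≈-x _) (-‿involutive 1#)) ⟩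
    1# ^ l                    ≈⟨ 1^n≈1 l ⟩
    1#                        ∎
    where l = inversions σ

  -- Determinants with selected columns

  module _ (M : Fin n → Fin n → Carrier) where

    -- The determinant of the matrix whose column v is column τ(v) of `M`, where columns may repeat.
    columnDet : Vec (Fin n) n → Carrier
    columnDet τ = ∑[ σ ∈ 𝔖 n ] (sgn σ * (∏[ v ∈ allFin n ] M (lookup σ v) (lookup τ v)))

    -- Applying the same swap to the summation variable keeps each product and reverses each sign.
    columnDet-swapAt : ∀ i τ → columnDet (swapAt i τ) ≈ - columnDet τ
    columnDet-swapAt i τ = begin
      columnDet (swapAt i τ)
        ≈⟨ Sum.⨁-reindex {h = swapAt i} {xs = 𝔖 n} (involution-↭ (unique-𝔖 n)
             (∈-𝔖⁺ ∘ swapAt-unique i ∘ ∈-𝔖⁻) (λ _ → swapAt-involutive i _)) ⟨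
      (∑[ σ ∈ 𝔖 n ] (sgn (swapAt i σ) * (∏[ v ∈ allFin n ] M (lookup (swapAt i σ) v) (lookup (swapAt i τ) v))))
        ≈⟨ Sum.cong-∈ (𝔖 n) (λ σ σ∈ → trans (*-cong (sgn-swapAt i (∈-𝔖⁻ σ∈)) (Product.⨁-swapAt i σ τ {M}))
             (sym (-‿distribˡ-* _ _))) ⟩
      (∑[ σ ∈ 𝔖 n ] (- (sgn σ * (∏[ v ∈ allFin n ] M (lookup σ v) (lookup τ v)))))
        ≈⟨ sum-- (𝔖 n) ⟩
      - columnDet τ ∎

    -- Adjacent swaps change the value only by a sign, and once two equal columns are neighbours the
    -- value is its own negative.
    columnDet-¬unique : ∀ τ → ¬ Unique τ → columnDet τ ≈ 0#
    columnDet-¬unique = ¬unique-induction n (λ τ → columnDet τ ≈ 0#)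
      (λ i τ D≈0 → trans (sym (-‿involutive _)) (trans (-‿cong (trans (sym (columnDet-swapAt i τ)) D≈0)) -0#≈0#))
      (λ i τ eq → x≈-x⇒x≈0 (trans (reflexive (≡.cong columnDet (≡.sym eq))) (columnDet-swapAt i τ)))

  -- The Möbius function

  μ-squarefree : ∀ {m} → .{{NonZero m}} → (f : PrimeFactorisation m) → ListUnique.Unique (factors f) →
                 μ m ≡ (- 1#) ^ length (factors f)
  μ-squarefree {m@(suc _)} f f! = ≡.trans
    (≡.cong (if_then (- 1#) ^ length ps else 0#)
      (dec-true (UniqueList.unique? ℕ._≟_ ps) (unique-resp-↭ (↭-sym ps↭) f!)))
    (≡.cong ((- 1#) ^_) (↭-length ps↭))
    where
    ps = factors (factorise m)
    ps↭ : ps ↭ factors f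
    ps↭ = factorisationUnique (factorise m) f

  μ-¬squarefree : ∀ {m} → .{{NonZero m}} → (f : PrimeFactorisation m) → ¬ ListUnique.Unique (factors f) → μ m ≡ 0#
  μ-¬squarefree {m@(suc _)} f ¬f! = ≡.cong (if_then (- 1#) ^ length ps else 0#)
    (dec-false (UniqueList.unique? ℕ._≟_ ps) (¬f! ∘ unique-resp-↭ (factorisationUnique (factorise m) f)))
    where ps = factors (factorise m)

  -- By unique factorisation `μ` may be computed from any factorisation, here from that of `c` with
  -- `p` put in front. As p ∤ c, the new prime repeats none of the old ones.
  μ-prime-* : ∀ {p c} → Prime p → .{{NonZero c}} → ¬ p ∣ c → μ (p ℕ.* c) ≈ - μ c
  μ-prime-* {p} {c} p-prime p∤c = by-cases (UniqueList.unique? ℕ._≟_ ps)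
    where
    instance
      _ = prime⇒nonZero p-prime
      _ = ℕ.m*n≢0 p c
    f = factorise c
    ps = factors f
    p∉ps : ListAll.All (p ≢_) ps
    p∉ps = ListAll.tabulate λ { q∈ ≡.refl → p∤c
      (≡.subst (p ∣_) (≡.sym (PrimeFactorisation.isFactorisation f)) (∈⇒∣product q∈)) }
    by-cases : Dec (ListUnique.Unique ps) → μ (p ℕ.* c) ≈ - μ c
    by-cases (yes ps!) = begin
      μ (p ℕ.* c)                  ≡⟨ μ-squarefree (prime-∷ p-prime f) (p∉ps ListAllPairs.∷ ps!) ⟩
      - 1# * (- 1#) ^ length ps    ≈⟨ -1*x≈-x _ ⟩
      - (- 1#) ^ length ps         ≡⟨ ≡.cong -_ (μ-squarefree f ps!) ⟨
      - μ c                        ∎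
    by-cases (no ¬ps!) = begin
      μ (p ℕ.* c)   ≡⟨ μ-¬squarefree (prime-∷ p-prime f) (¬ps! ∘ ListAllPairs.tail) ⟩
      0#            ≈⟨ -0#≈0# ⟨
      - 0#          ≡⟨ ≡.cong -_ (μ-¬squarefree f ¬ps!) ⟨
      - μ c         ∎

  μ-square-∣ : ∀ {p c} → Prime p → NonZero c → p ℕ.* p ∣ c → μ c ≈ 0#
  μ-square-∣ {p} p-prime nz (divides q ≡.refl) = reflexive (≡.trans (≡.cong μ q*pp≡ppq)
    (μ-¬squarefree {{≡.subst NonZero q*pp≡ppq nz}} (prime-∷ p-prime (prime-∷ p-prime (factorise q {{q≢0}})))
      λ { ((p≢p ListAll.∷ _) ListAllPairs.∷ _) → p≢p ≡.refl }))
    where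
    q≢0 : NonZero q
    q≢0 = *-nonZeroˡ q nz
    q*pp≡ppq : q ℕ.* (p ℕ.* p) ≡ p ℕ.* (p ℕ.* q)
    q*pp≡ppq = ≡.trans (ℕ.*-comm q _) (ℕ.*-assoc p p q)

  -- The Möbius transform in one variable

  mobius : (ℕ → Carrier) → ℕ → Carrier
  mobius f d = ∑[ δ ∈ divisors d ] (μ (d div δ) * f δ)

  mobius-cong : ∀ {f g} d → (∀ δ → NonZero δ → f δ ≈ g δ) → mobius f d ≈ mobius g d
  mobius-cong d f≈g = Sum.cong-∈ (divisors d) λ δ δ∈ → *-congˡ (f≈g δ (proj₁ (∈-divisors⁻ d δ∈)))

  -- Passing to complementary divisors puts the summation variable itself under `μ`, where `toggle`
  -- can act on it.
  mobius-complement : ∀ f d → .{{NonZero d}} → mobius f d ≈ ∑[ c ∈ divisors d ] (μ c * f (d div c))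
  mobius-complement f d = begin
    mobius f d
      ≈⟨ Sum.⨁-reindex (involution-↭ (unique-divisors d) closed invol) ⟨
    (∑[ c ∈ divisors d ] (μ (d div (d div c)) * f (d div c)))
      ≈⟨ Sum.cong-∈ (divisors d) (λ c c∈ → *-congʳ (reflexive (≡.cong μ (invol c∈)))) ⟩
    (∑[ c ∈ divisors d ] (μ c * f (d div c))) ∎
    where
    invol : ∀ {c} → c ∈ divisors d → d div (d div c) ≡ c
    invol c∈ with c≢0 , c∣d ← ∈-divisors⁻ d c∈ = div-involutive {{c≢0}} c∣d
    closed : ∀ {c} → c ∈ divisors d → d div c ∈ divisors d
    closed {c} c∈ with c≢0 , c∣d ← ∈-divisors⁻ d c∈ = ∈-divisors⁺
      {{*-nonZeroˡ (d div c) (≡.subst NonZero (≡.sym eq) (recompute-nonZero d))}}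
      (divides c (≡.trans (≡.sym eq) (ℕ.*-comm (d div c) c)))
      where
      eq = div-*-cancel {{c≢0}} c∣d

  -- The involution `t` negates every term. Where it multiplies or divides by `p`, `μ` changes sign
  -- while `f` sees arguments with equal gcd with `r`; where it fixes `c`, the square of `p` divides
  -- `c` and the term is 0.
  mobius-vanish : ∀ {f d r} → .{{NonZero d}} → (∀ a b → NonZero a → NonZero b → gcd a r ≡ gcd b r → f a ≈ f b) →
                  ¬ d ∣ r → mobius f d ≈ 0#
  mobius-vanish {f} {d} {r} f-even d∤r with p , p-prime , pg∣d ← ∤⇒∃prime {d} {r} d∤r =
    trans (mobius-complement f d) (x≈-x⇒x≈0 (begin
      (∑[ c ∈ divisors d ] T c)
        ≈⟨ Sum.⨁-reindex (involution-↭ (unique-divisors d) closed invol) ⟨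
      (∑[ c ∈ divisors d ] T (t c))
        ≈⟨ Sum.cong-∈ (divisors d) (λ c c∈ → T-antisym (proj₂ (toggle p c)) c∈ (closed c∈)) ⟩
      (∑[ c ∈ divisors d ] (- T c))
        ≈⟨ sum-- (divisors d) ⟩
      - (∑[ c ∈ divisors d ] T c) ∎))
    where
    instance
      p≢0 = prime⇒nonZero p-prime
    T : ℕ → Carrier
    T c = μ c * f (d div c)
    t : ℕ → ℕ
    t c = proj₁ (toggle p c)
    closed : ∀ {c} → c ∈ divisors d → t c ∈ divisors d
    closed {c} c∈ with c≢0 , c∣d ← ∈-divisors⁻ d c∈ = ∈-divisors⁺ {{toggle-nonZero (proj₂ (toggle p c)) c≢0}}
      (toggle-∣ p-prime (m*n∣⇒m∣ p (gcd d r) pg∣d) (proj₂ (toggle p c)) c∣d)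
    invol : ∀ {c} → c ∈ divisors d → t (t c) ≡ c
    invol {c} _ = toggle-unique (proj₂ (toggle p (t c))) (toggle-sym (proj₂ (toggle p c)))
    T-up : ∀ {c} → ¬ p ∣ c → c ∈ divisors d → p ℕ.* c ∈ divisors d → T (p ℕ.* c) ≈ - T c
    T-up {c} p∤c c∈ pc∈ with c≢0 , _ ← ∈-divisors⁻ d c∈ | pc≢0 , divides e d≡e*pc ← ∈-divisors⁻ d pc∈ =
      trans (*-cong (μ-prime-* p-prime {{c≢0}} p∤c) f≈) (sym (-‿distribˡ-* _ _))
      where
      d≡pe*c : d ≡ p ℕ.* e ℕ.* c
      d≡pe*c = ≡.trans d≡e*pc (≡.trans (≡.sym (ℕ.*-assoc e p c)) (≡.cong (ℕ._* c) (ℕ.*-comm e p)))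
      div-c : d div c ≡ p ℕ.* e
      div-c = ≡.trans (≡.cong (_div c) d≡pe*c) (div-*ʳ (p ℕ.* e) c {{c≢0}})
      div-pc : d div (p ℕ.* c) ≡ e
      div-pc = ≡.trans (≡.cong (_div (p ℕ.* c)) d≡e*pc) (div-*ʳ e (p ℕ.* c) {{pc≢0}})
      pe≢0 : NonZero (p ℕ.* e)
      pe≢0 = *-nonZeroˡ (p ℕ.* e) (≡.subst NonZero d≡pe*c (recompute-nonZero d))
      -- The complementary divisors of c and pc are pe and e, to which `gcd-cancel-prime` applies.
      f≈ : f (d div (p ℕ.* c)) ≈ f (d div c)
      f≈ = trans (reflexive (≡.cong f div-pc)) (trans
        (f-even e (p ℕ.* e) (*-nonZeroʳ p pe≢0) pe≢0
          (≡.sym (gcd-cancel-prime p-prime p∤c (≡.trans d≡pe*c (ℕ.*-comm _ c)) pg∣d)))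
        (reflexive (≡.cong f (≡.sym div-c))))
    T-antisym : ∀ {c c′} → Toggle p c c′ → c ∈ divisors d → c′ ∈ divisors d → T c′ ≈ - T c
    T-antisym (up p∤c ≡.refl)     c∈ c′∈ = T-up p∤c c∈ c′∈
    T-antisym (down p∤c′ ≡.refl)  c∈ c′∈ = trans (sym (-‿involutive _)) (-‿cong (sym (T-up p∤c′ c′∈ c∈)))
    T-antisym (stay pp∣c ≡.refl) c∈ _ = trans T≈0 (trans (sym -0#≈0#) (-‿cong (sym T≈0)))
      where T≈0 = trans (*-congʳ (μ-square-∣ p-prime (proj₁ (∈-divisors⁻ d c∈)) pp∣c)) (zeroˡ _)

  -- The Möbius transform in several variables

  multiMobius : ∀ {k} → (Vec ℕ k → Carrier) → Vec ℕ k → Carrier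
  multiMobius f []       = f []
  multiMobius f (d ∷ ds) = mobius (λ δ → multiMobius (f ∘ (δ ∷_)) ds) d

  multiMobius-cong : {f g : Vec ℕ k → Carrier} → (∀ ns → All NonZero ns → f ns ≈ g ns) →
                     ∀ ds → multiMobius f ds ≈ multiMobius g ds
  multiMobius-cong f≈g []       = f≈g [] []
  multiMobius-cong f≈g (d ∷ ds) = mobius-cong d λ δ δ≢0 →
    multiMobius-cong (λ ns ns≢0 → f≈g (δ ∷ ns) (δ≢0 ∷ ns≢0)) ds

  -- Comparing two vectors with equal gcds, instead of a vector with its gcds, makes the property
  -- pass at once to the function with its first argument fixed.
  EvenMod : ℕ → (Vec ℕ k → Carrier) → Set ℓ
  EvenMod r f = ∀ ns ms → All NonZero ns → All NonZero ms →
                Vec.map (λ m → gcd m r) ns ≡ Vec.map (λ m → gcd m r) ms → f ns ≈ f ms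

  Even⇒EvenMod : {F : ℕ → Vec ℕ k → Carrier} → Even F → ∀ r → NonZero r → EvenMod r (F r)
  Even⇒EvenMod {F = F} F-even r r≢0 ns ms ns≢0 ms≢0 eq =
    trans (F-even r ns r≢0 ns≢0) (trans (reflexive (≡.cong (F r) eq)) (sym (F-even r ms r≢0 ms≢0)))

  -- At the first entry that does not divide `r` the one-variable result applies; the sums over the
  -- earlier entries then consist of zeros.
  multiMobius-vanish : ∀ {r} {f : Vec ℕ k → Carrier} {ds} → EvenMod r f → All NonZero ds →
                       ¬ All (_∣ r) ds → multiMobius f ds ≈ 0#
  multiMobius-vanish {ds = []} f-even _ ¬∣r = contradiction [] ¬∣r
  multiMobius-vanish {r = r} {f} {d ∷ ds} f-even (d≢0 ∷ ds≢0) ¬∣r with d ∣? r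
  ... | no d∤r  = mobius-vanish {{d≢0}} (λ a b a≢0 b≢0 eq → multiMobius-cong
    (λ ns ns≢0 → f-even (a ∷ ns) (b ∷ ns) (a≢0 ∷ ns≢0) (b≢0 ∷ ns≢0) (≡.cong (_∷ _) eq)) ds) d∤r
  ... | yes d∣r = Sum.⨁-ε (divisors d) λ δ δ∈ → trans (*-congˡ (multiMobius-vanish
    (λ ns ms ns≢0 ms≢0 eq → let δ≢0 = proj₁ (∈-divisors⁻ d δ∈) in
      f-even (δ ∷ ns) (δ ∷ ms) (δ≢0 ∷ ns≢0) (δ≢0 ∷ ms≢0) (≡.cong (gcd δ r ∷_) eq))
    ds≢0 (λ ds∣r → ¬∣r (d∣r ∷ ds∣r)))) (zeroʳ _)

  multiMobius-replicate : ∀ r k {f : Vec ℕ k → Carrier} → multiMobius f (replicate k r) ≈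
    ∑[ δs ∈ tuples (divisors r) k ] (f δs * (∏[ j ∈ allFin k ] μ (r div lookup δs j)))
  multiMobius-replicate r zero    = sym (trans (+-identityʳ _) (*-identityʳ _))
  multiMobius-replicate r (suc k) {f} = begin
    (∑[ δ ∈ divisors r ] (μ (r div δ) * multiMobius (f ∘ (δ ∷_)) (replicate k r)))
      ≈⟨ Sum.⨁-cong (divisors r) (λ δ → trans (*-congˡ (multiMobius-replicate r k))
           (sym (sum-*ˡ _ (tuples (divisors r) k)))) ⟩
    (∑[ δ ∈ divisors r ] (∑[ δs ∈ tuples (divisors r) k ]
      (μ (r div δ) * (f (δ ∷ δs) * (∏[ j ∈ allFin k ] μ (r div lookup δs j))))))
      ≈⟨ Sum.⨁-cong (divisors r) (λ δ → Sum.⨁-cong (tuples (divisors r) k) λ δs →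
           trans (x∙yz≈y∙xz _ _ _) (*-congˡ (sym (Product.⨁-allFin-suc k)))) ⟩
    (∑[ δ ∈ divisors r ] (∑[ δs ∈ tuples (divisors r) k ]
      (f (δ ∷ δs) * (∏[ j ∈ allFin (suc k) ] μ (r div lookup (δ ∷ δs) j)))))
      ≈⟨ Sum.⨁-product _∷_ (divisors r) (tuples (divisors r) k) ⟨
    (∑[ δs ∈ tuples (divisors r) (suc k) ] (f δs * (∏[ j ∈ allFin (suc k) ] μ (r div lookup δs j)))) ∎

  -- Ramanujan sums and Fourier coefficients

  ramanujan-1 : ∀ m → ramanujan m 1 ≈ μ m
  ramanujan-1 m = begin
    ramanujan m 1                ≡⟨ ≡.cong (λ g → ∑[ d ∈ divisors g ] (μ (m div d) * ι d)) (gcd-zeroʳ m) ⟩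
    μ (m div 1) * ι 1 + 0#       ≈⟨ +-identityʳ _ ⟩
    μ (m div 1) * ι 1            ≈⟨ *-cong (reflexive (≡.cong μ (n/1≡n m))) (+-identityʳ 1#) ⟩
    μ m * 1#                     ≈⟨ *-identityʳ _ ⟩
    μ m                          ∎
    where open import Data.Nat.DivMod using (n/1≡n)

  ι-^ : ∀ r k → ι (r ℕ.^ k) ≈ ι r ^ k
  ι-^ r zero    = +-identityʳ 1#
  ι-^ r (suc k) = trans (×1-homo-* r (r ℕ.^ k)) (*-congˡ (ι-^ r k))
    where open import Algebra.Properties.Semiring.Mult semiring using (×1-homo-*)

  -- When every d is r, the second argument r/d of each Ramanujan sum is 1, which leaves the Möbius
  -- function; the k-th power of r cancels the normalisation of `α`.
  multiMobius-α : ∀ (F : ℕ → Vec ℕ k → Carrier) r → .{{_ : NonZero r}} →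
    multiMobius (F r) (replicate k r) ≈ ι r ^ k * α F r (replicate k r)
  multiMobius-α {k} F r = begin
    multiMobius (F r) (replicate k r)
      ≈⟨ multiMobius-replicate r k ⟩
    (∑[ δs ∈ tuples (divisors r) k ] (F r δs * (∏[ j ∈ allFin k ] μ (r div lookup δs j))))
      ≈⟨ Sum.⨁-cong (tuples (divisors r) k) (λ δs → *-congˡ (Product.⨁-cong (allFin k) λ j →
           sym (trans (reflexive (≡.cong (ramanujan (r div lookup δs j)) (r-div j))) (ramanujan-1 (r div lookup δs j))))) ⟩
    S
      ≈⟨ *-identityˡ S ⟨
    1# * S
      ≈⟨ *-congʳ (trans (*-congʳ (sym (ι-^ r k))) (inverse (r ℕ.^ k) {{ℕ.m^n≢0 r k}})) ⟨
    ι r ^ k * recip (r ℕ.^ k) {{ℕ.m^n≢0 r k}} * S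
      ≈⟨ *-assoc _ _ _ ⟩
    ι r ^ k * α F r (replicate k r) ∎
    where
    S = ∑[ δs ∈ tuples (divisors r) k ]
      (F r δs * (∏[ j ∈ allFin k ] ramanujan (r div lookup δs j) (r div lookup (replicate k r) j)))
    r-div : ∀ j → r div lookup (replicate k r) j ≡ 1
    r-div j = ≡.trans (≡.cong (r div_) (Vec.lookup-replicate j r))
      (≡.trans (≡.cong (_div r) (≡.sym (ℕ.*-identityˡ r))) (div-*ʳ 1 r))

  weighted-swap : {B : Set a} (xs : List A) (ys : List B) (α : A → Carrier) (β : B → Carrier) {h : A → B → Carrier} →
    ∑[ x ∈ xs ] (α x * (∑[ y ∈ ys ] (β y * h x y))) ≈ ∑[ y ∈ ys ] (β y * (∑[ x ∈ xs ] (α x * h x y)))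
  weighted-swap xs ys α β = trans (Sum.⨁-cong xs (λ x → sym (sum-*ˡ (α x) ys)))
    (trans (Sum.⨁-swap xs ys) (Sum.⨁-cong ys (λ y →
      trans (Sum.⨁-cong xs (λ x → x∙yz≈y∙xz _ _ _)) (sum-*ˡ (β y) xs))))

  signs : ∀ {k} → Vec (Vec (Fin n) n) k → Carrier
  signs {k = k} σs = ∏[ j ∈ allFin k ] sgn (lookup σs j)

  at : Fin n → Vec (Vec (Fin n) n) k → Vec (Fin n) k
  at v = Vec.map (λ σ → lookup σ v)

  -- The Möbius matrix of a factor-closed set

  module FactorClosedSet {n} (x : Fin n → ℕ) (x≢0 : ∀ v → NonZero (x v)) (x-injective : Injective _≡_ _≡_ x)
    (closed : FactorClosed (λ m → ∃ λ v → x v ≡ m)) where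

    M : Fin n → Fin n → Carrier
    M i e = if does (x e ∣? x i) then μ (x i div x e) else 0#

    M-∣ : ∀ {i e} → x e ∣ x i → M i e ≡ μ (x i div x e)
    M-∣ {i} {e} ∣i = ≡.cong (if_then μ (x i div x e) else 0#) (dec-true (x e ∣? x i) ∣i)

    M-∤ : ∀ {i e} → ¬ x e ∣ x i → M i e ≡ 0#
    M-∤ {i} {e} ∤i = ≡.cong (if_then μ (x i div x e) else 0#) (dec-false (x e ∣? x i) ∤i)

    M-diagonal : ∀ i → M i i ≈ 1#
    M-diagonal i = reflexive (≡.trans (M-∣ {i} ∣-refl) (≡.cong μ
      (≡.trans (≡.cong (_div x i) (≡.sym (ℕ.*-identityˡ (x i)))) (div-*ʳ 1 (x i) {{x≢0 i}}))))

    mobius-M : ∀ f i → mobius f (x i) ≈ ∑[ e ∈ allFin n ] (M i e * f (x e))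
    mobius-M f i = begin
      mobius f (x i)
        ≈⟨ Sum.⨁-reindex (factorClosed⇒divisors-↭ x x≢0 x-injective closed i) ⟨
      (∑[ e ∈ List.filter P? (allFin n) ] (μ (x i div x e) * f (x e)))
        ≈⟨ Sum.cong-∈ (List.filter P? (allFin n)) (λ e e∈ → *-congʳ (reflexive (≡.sym
             (M-∣ {i} {e} (proj₂ (∈-filter⁻ P? {xs = allFin n} e∈)))))) ⟩
      (∑[ e ∈ List.filter P? (allFin n) ] (M i e * f (x e)))
        ≈⟨ Sum.⨁-filter P? (allFin n) (λ e e∤i → trans (*-congʳ (reflexive (M-∤ {i} {e} e∤i))) (zeroˡ _)) ⟩
      (∑[ e ∈ allFin n ] (M i e * f (x e))) ∎
      where P? = λ e → x e ∣? x i

    -- This is unitriangularity without sorting: the product for `σ` can be nonzero only if each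
    -- x(τ(v)) divides x(σ(v)), which forces σ = τ, and the diagonal entries are μ(1) = 1.
    columnDet-unique : ∀ {τ} → Unique τ → columnDet M τ ≈ sgn τ
    columnDet-unique {τ} τ! = begin
      columnDet M τ
        ≈⟨ Sum.⨁-single (unique-𝔖 n) (∈-𝔖⁺ τ!) off-diagonal ⟩
      sgn τ * (∏[ v ∈ allFin n ] M (lookup τ v) (lookup τ v))
        ≈⟨ *-congˡ (Product.⨁-ε (allFin n) (λ v _ → M-diagonal (lookup τ v))) ⟩
      sgn τ * 1#
        ≈⟨ *-identityʳ _ ⟩
      sgn τ ∎
      where
      off-diagonal : ∀ σ → σ ∈ 𝔖 n → σ ≢ τ → sgn σ * (∏[ v ∈ allFin n ] M (lookup σ v) (lookup τ v)) ≈ 0#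
      off-diagonal σ σ∈ σ≢τ
        with v , τv∤σv ← Fin.¬∀⟶∃¬ n _ (λ v → x (lookup τ v) ∣? x (lookup σ v))
               (σ≢τ ∘ ≡.sym ∘ divides-pointwise⇒≡ x x≢0 x-injective (∈-𝔖⁻ σ∈) τ!) =
        trans (*-congˡ (prod-zero (∈-allFin v) (reflexive (M-∤ {lookup σ v} {lookup τ v} τv∤σv)))) (zeroʳ _)

    -- Multiplicativity of the determinant for a factor `M` of determinant 1: after expansion,
    -- selections with a repeated column vanish and a permutation `τ` contributes its sign. The
    -- function may depend on `v`, since the remaining indices of an entry do.
    mobius-det : (g : Fin n → ℕ → Carrier) →
      ∑[ σ ∈ 𝔖 n ] (sgn σ * (∏[ v ∈ allFin n ] mobius (g v) (x (lookup σ v)))) ≈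
      ∑[ τ ∈ 𝔖 n ] (sgn τ * (∏[ v ∈ allFin n ] g v (x (lookup τ v))))
    mobius-det g = begin
      (∑[ σ ∈ 𝔖 n ] (sgn σ * (∏[ v ∈ allFin n ] mobius (g v) (x (lookup σ v)))))
        ≈⟨ Sum.⨁-cong (𝔖 n) (λ σ → *-congˡ (trans
             (Product.⨁-cong (allFin n) (λ v → mobius-M (g v) (lookup σ v))) (prod-sum n (allFin n)))) ⟩
      (∑[ σ ∈ 𝔖 n ] (sgn σ * (∑[ τ ∈ T ] (∏[ v ∈ allFin n ] (M (lookup σ v) (lookup τ v) * g v (x (lookup τ v)))))))
        ≈⟨ Sum.⨁-cong (𝔖 n) (λ σ → trans (sym (sum-*ˡ _ T)) (Sum.⨁-cong T λ τ →
             trans (*-congˡ (Product.⨁-∙ (allFin n))) (sym (*-assoc _ _ _)))) ⟩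
      (∑[ σ ∈ 𝔖 n ] (∑[ τ ∈ T ] (sgn σ * (∏[ v ∈ allFin n ] M (lookup σ v) (lookup τ v)) * G τ)))
        ≈⟨ trans (Sum.⨁-swap (𝔖 n) T) (Sum.⨁-cong T (λ τ → sum-*ʳ (G τ) (𝔖 n))) ⟩
      (∑[ τ ∈ T ] (columnDet M τ * G τ))
        ≈⟨ Sum.⨁-filter unique? T (λ τ ¬τ! → trans (*-congʳ (columnDet-¬unique M τ ¬τ!)) (zeroˡ _)) ⟨
      (∑[ τ ∈ 𝔖 n ] (columnDet M τ * G τ))
        ≈⟨ Sum.cong-∈ (𝔖 n) (λ τ τ∈ → *-congʳ (columnDet-unique (∈-𝔖⁻ τ∈))) ⟩
      (∑[ τ ∈ 𝔖 n ] (sgn τ * G τ)) ∎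
      where
      T = tuples (allFin n) n
      G : Vec (Fin n) n → Carrier
      G τ = ∏[ v ∈ allFin n ] g v (x (lookup τ v))

    sum-signs-∷ : ∀ k {h : Vec (Vec (Fin n) n) (suc k) → Carrier} →
      ∑[ σs ∈ tuples (𝔖 n) (suc k) ] (signs σs * h σs) ≈
      ∑[ σ ∈ 𝔖 n ] (sgn σ * (∑[ σs ∈ tuples (𝔖 n) k ] (signs σs * h (σ ∷ σs))))
    sum-signs-∷ k = trans (Sum.⨁-product _∷_ (𝔖 n) (tuples (𝔖 n) k)) (Sum.⨁-cong (𝔖 n) λ σ →
      trans (Sum.⨁-cong (tuples (𝔖 n) k) (λ σs → trans (*-congʳ (Product.⨁-allFin-suc k)) (*-assoc _ _ _)))
        (sum-*ˡ _ (tuples (𝔖 n) k)))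

    -- One direction at a time. Interchanging the sums isolates the first signed direction with the
    -- others fixed; `mobius-det` removes its transform, and induction treats the rest for each
    -- fixed `σ`.
    multiMobius-det : ∀ k (f : Fin n → Vec ℕ k → Carrier) →
      ∑[ σs ∈ tuples (𝔖 n) k ] (signs σs * (∏[ v ∈ allFin n ] multiMobius (f v) (Vec.map x (at v σs)))) ≈
      ∑[ σs ∈ tuples (𝔖 n) k ] (signs σs * (∏[ v ∈ allFin n ] f v (Vec.map x (at v σs))))
    multiMobius-det zero    f = refl
    multiMobius-det (suc k) f = begin
      (∑[ σs ∈ tuples (𝔖 n) (suc k) ] (signs σs * (∏[ v ∈ allFin n ] multiMobius (f v) (Vec.map x (at v σs)))))
        ≈⟨ sum-signs-∷ k ⟩
      (∑[ σ ∈ 𝔖 n ] (sgn σ * (∑[ σs ∈ U ] (signs σs *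
        (∏[ v ∈ allFin n ] mobius (g σs v) (x (lookup σ v)))))))
        ≈⟨ weighted-swap (𝔖 n) U sgn signs ⟩
      (∑[ σs ∈ U ] (signs σs * (∑[ σ ∈ 𝔖 n ] (sgn σ *
        (∏[ v ∈ allFin n ] mobius (g σs v) (x (lookup σ v)))))))
        ≈⟨ Sum.⨁-cong U (λ σs → *-congˡ (mobius-det (g σs))) ⟩
      (∑[ σs ∈ U ] (signs σs * (∑[ σ ∈ 𝔖 n ] (sgn σ *
        (∏[ v ∈ allFin n ] g σs v (x (lookup σ v)))))))
        ≈⟨ weighted-swap U (𝔖 n) signs sgn ⟩
      (∑[ σ ∈ 𝔖 n ] (sgn σ * (∑[ σs ∈ U ] (signs σs * (∏[ v ∈ allFin n ] g σs v (x (lookup σ v)))))))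
        ≈⟨ Sum.⨁-cong (𝔖 n) (λ σ → *-congˡ (multiMobius-det k (λ v → f v ∘ (x (lookup σ v) ∷_)))) ⟩
      (∑[ σ ∈ 𝔖 n ] (sgn σ * (∑[ σs ∈ U ] (signs σs *
        (∏[ v ∈ allFin n ] f v (x (lookup σ v) ∷ Vec.map x (at v σs)))))))
        ≈⟨ sum-signs-∷ k ⟨
      (∑[ σs ∈ tuples (𝔖 n) (suc k) ] (signs σs * (∏[ v ∈ allFin n ] f v (Vec.map x (at v σs))))) ∎
      where
      U = tuples (𝔖 n) k
      g : Vec (Vec (Fin n) n) k → Fin n → ℕ → Carrier
      g σs v δ = multiMobius (f v ∘ (δ ∷_)) (Vec.map x (at v σs))

    -- Evaluation of the hyperdeterminant

    module _ {k} (F : ℕ → Vec ℕ k → Carrier) (F-even : Even F) where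

      diagonal : Fin n → Carrier
      diagonal i = multiMobius (F (x i)) (replicate k (x i))

      entries : Vec (Fin n) n → Vec (Vec (Fin n) n) k → Carrier
      entries σ σs = ∏[ v ∈ allFin n ] multiMobius (F (x (lookup σ v))) (Vec.map x (at v σs))

      divides-all⇒replicate : ∀ {m σ} → Unique σ → (σs : Vec (Vec (Fin n) n) m) → All Unique σs →
        (∀ v → All (_∣ x (lookup σ v)) (Vec.map x (at v σs))) → σs ≡ replicate m σ
      divides-all⇒replicate σ! []       _            _  = ≡.refl
      divides-all⇒replicate σ! (τ ∷ σs) (τ! ∷ σs!) σs∣ = ≡.cong₂ _∷_
        (divides-pointwise⇒≡ x x≢0 x-injective σ! τ! (λ v → All.head (σs∣ v)))
        (divides-all⇒replicate σ! σs σs! (λ v → All.tail (σs∣ v)))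

      -- If some permutation differs from `σ`, divisibility fails at some `v`, and evenness makes
      -- the factor at that `v` vanish.
      entries-vanish : ∀ {σ σs} → Unique σ → All Unique σs → σs ≢ replicate k σ → entries σ σs ≈ 0#
      entries-vanish {σ} {σs} σ! σs! σs≢
        with v , ¬∣ ← Fin.¬∀⟶∃¬ n _ (λ v → All.all? (_∣? x (lookup σ v)) (Vec.map x (at v σs)))
               (σs≢ ∘ divides-all⇒replicate σ! σs σs!) =
        prod-zero (∈-allFin v) (multiMobius-vanish (Even⇒EvenMod F-even (x (lookup σ v)) (x≢0 _))
          (All.map⁺ (All.universal x≢0 (at v σs))) ¬∣)

      entries-replicate : ∀ {σ} → Unique σ → entries σ (replicate k σ) ≈ ∏[ v ∈ allFin n ] diagonal v
      entries-replicate {σ} σ! = trans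
        (Product.⨁-cong (allFin n) (λ v → reflexive (≡.cong (multiMobius (F (x (lookup σ v))))
          (≡.trans (≡.cong (Vec.map x) (Vec.map-replicate (λ τ → lookup τ v) σ k)) (Vec.map-replicate x _ k)))))
        (Product.⨁-reindex (lookup-↭-allFin σ!))

      signs-replicate : ∀ m (σ : Vec (Fin n) n) → signs (replicate m σ) ≈ sgn σ ^ m
      signs-replicate zero    σ = refl
      signs-replicate (suc m) σ = trans (Product.⨁-allFin-suc m) (*-congˡ (signs-replicate m σ))

      sum-entries : ∀ {σ} → Unique σ →
        ∑[ σs ∈ tuples (𝔖 n) k ] (signs σs * entries σ σs) ≈ sgn σ ^ k * (∏[ v ∈ allFin n ] diagonal v)
      sum-entries {σ} σ! = trans
        (Sum.⨁-single (unique-tuples (unique-𝔖 n) k) (∈-tuples⁺ (All-replicate k (∈-𝔖⁺ σ!)))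
          (λ σs σs∈ σs≢ → trans (*-congˡ (entries-vanish σ! (All.map ∈-𝔖⁻ (∈-tuples⁻ k σs∈)) σs≢)) (zeroʳ _)))
        (*-cong (signs-replicate k σ) (entries-replicate σ!))

      sgn-even-power : ∀ (σ : Vec (Fin n) n) {m} → 2 ∣ m → sgn σ ^ m ≈ 1#
      sgn-even-power σ (divides zero ≡.refl)    = refl
      sgn-even-power σ (divides (suc q) ≡.refl) = trans (sym (*-assoc _ _ _))
        (trans (*-cong (sgn*sgn≈1 σ) (sgn-even-power σ (divides q ≡.refl))) (*-identityˡ _))

      -- Direction 1 is signed exactly when `k` is odd, so the total exponent of the sign is even in
      -- both cases.
      sgn-parity : ∀ (σ : Vec (Fin n) n) → sgn σ ^ η (I k) zero * sgn σ ^ k ≈ 1#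
      sgn-parity σ = by-cases (2 ∣? k)
        where
        by-cases : (d : Dec (2 ∣ k)) → sgn σ ^ η ((if does d then outside else inside) ∷ ⊤) (zero {k}) * sgn σ ^ k ≈ 1#
        by-cases (yes 2∣k) = trans (*-identityˡ _) (sgn-even-power σ 2∣k)
        by-cases (no  2∤k) = trans (*-congʳ (*-identityʳ _)) (sgn-even-power σ (∤⇒∣suc 2∤k))

      det-mobius : det (I k) (λ is → F (x (head is)) (Vec.map x (tail is))) ≈ ∏[ v ∈ allFin n ] diagonal v
      det-mobius = begin
        recip (n !) {{ℕ._!≢0 n}} * (∑[ σs ∈ tuples (𝔖 n) (suc k) ] W σs)
          ≈⟨ *-congˡ sum ⟩
        recip (n !) {{ℕ._!≢0 n}} * (ι (n !) * Δ)
          ≈⟨ *-assoc _ _ _ ⟨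
        recip (n !) {{ℕ._!≢0 n}} * ι (n !) * Δ
          ≈⟨ *-congʳ (trans (*-comm _ _) (inverse (n !) {{ℕ._!≢0 n}})) ⟩
        1# * Δ
          ≈⟨ *-identityˡ Δ ⟩
        Δ ∎
        where
        Δ = ∏[ v ∈ allFin n ] diagonal v
        entry : Vec (Fin n) (suc k) → Carrier
        entry is = F (x (head is)) (Vec.map x (tail is))
        W : Vec (Vec (Fin n) n) (suc k) → Carrier
        W σs = (∏[ j ∈ allFin (suc k) ] (sgn (lookup σs j) ^ η (I k) j)) * (∏[ v ∈ allFin n ] entry (at v σs))
        η-suc : ∀ j → η (I k) (suc j) ≡ 1
        η-suc j = ≡.cong (if_then 1 else 0) (Vec.lookup-replicate j _)
        const-sum : ∀ {B : Set} (xs : List B) → ∑[ y ∈ xs ] Δ ≈ ι (length xs) * Δ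
        const-sum []       = sym (zeroˡ Δ)
        const-sum (y ∷ xs) = trans (+-cong (sym (*-identityˡ Δ)) (const-sum xs)) (sym (distribʳ Δ _ _))
        W-∷ : ∀ σ σs → W (σ ∷ σs) ≈ sgn σ ^ η (I k) zero *
          (signs σs * (∏[ v ∈ allFin n ] F (x (lookup σ v)) (Vec.map x (at v σs))))
        W-∷ σ σs = trans (*-congʳ (trans (Product.⨁-allFin-suc k) (*-congˡ (Product.⨁-cong (allFin k) λ j →
          trans (reflexive (≡.cong (sgn (lookup σs j) ^_) (η-suc j))) (*-identityʳ _))))) (*-assoc _ _ _)
        sum : ∑[ σs ∈ tuples (𝔖 n) (suc k) ] W σs ≈ ι (n !) * Δ
        sum = begin
          (∑[ σs ∈ tuples (𝔖 n) (suc k) ] W σs)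
            ≈⟨ Sum.⨁-product _∷_ (𝔖 n) (tuples (𝔖 n) k) ⟩
          (∑[ σ ∈ 𝔖 n ] (∑[ σs ∈ tuples (𝔖 n) k ] W (σ ∷ σs)))
            -- For a fixed first permutation, `multiMobius-det` read backwards replaces `F` by its
            -- Möbius transform in all the other directions.
            ≈⟨ Sum.⨁-cong (𝔖 n) (λ σ → trans (Sum.⨁-cong (tuples (𝔖 n) k) (W-∷ σ)) (trans (sum-*ˡ _ (tuples (𝔖 n) k))
                 (*-congˡ (sym (multiMobius-det k (λ v → F (x (lookup σ v)))))))) ⟩
          (∑[ σ ∈ 𝔖 n ] (sgn σ ^ η (I k) zero * (∑[ σs ∈ tuples (𝔖 n) k ] (signs σs * entries σ σs))))
            -- Only the tuple with all permutations equal to `σ` survives, and its signs multiply to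
            -- 1.
            ≈⟨ Sum.cong-∈ (𝔖 n) (λ σ σ∈ → trans (*-congˡ (sum-entries (∈-𝔖⁻ σ∈)))
                 (trans (sym (*-assoc _ _ _)) (trans (*-congʳ (sgn-parity σ)) (*-identityˡ Δ)))) ⟩
          (∑[ σ ∈ 𝔖 n ] Δ)
            ≈⟨ const-sum (𝔖 n) ⟩
          ι (length (𝔖 n)) * Δ
            ≡⟨ ≡.cong (λ l → ι l * Δ) (length-𝔖 n) ⟩
          ι (n !) * Δ ∎

theorem4p6 : ∀ {c ℓ} (R : CommutativeℚAlgebra c ℓ) →
  let open CommutativeℚAlgebra R
      open Arithmetic R
  in
  ∀ {n} (x : Fin n → ℕ) (x≢0 : ∀ v → NonZero (x v)) → Injective _≡_ _≡_ x →
  FactorClosed (λ m → ∃ λ v → x v ≡ m) →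
  ∀ k → NonZero k →
  (F : ℕ → Vec ℕ k → Carrier) → Even F →
  det (I k) (λ is → F (x (head is)) (map x (tail is)))
    ≈ (∏[ v ∈ allFin n ] ι (x v)) ^ k
        * (∏[ v ∈ allFin n ] α F (x v) {{x≢0 v}} (replicate k (x v)))
theorem4p6 R {n} x x≢0 x-injective closed k _ F F-even = begin
  det (I k) (λ is → F (x (head is)) (map x (tail is)))
    ≈⟨ det-mobius F F-even ⟩
  (∏[ v ∈ allFin n ] multiMobius (F (x v)) (replicate k (x v)))
    ≈⟨ Product.⨁-cong (allFin n) (λ v → multiMobius-α F (x v) {{x≢0 v}}) ⟩
  (∏[ v ∈ allFin n ] (ι (x v) ^ k * α F (x v) {{x≢0 v}} (replicate k (x v))))
    ≈⟨ Product.⨁-∙ (allFin n) ⟩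
  (∏[ v ∈ allFin n ] (ι (x v) ^ k)) * (∏[ v ∈ allFin n ] α F (x v) {{x≢0 v}} (replicate k (x v)))
    ≈⟨ *-congʳ (prod-^ (allFin n) k) ⟩
  (∏[ v ∈ allFin n ] ι (x v)) ^ k * (∏[ v ∈ allFin n ] α F (x v) {{x≢0 v}} (replicate k (x v))) ∎
  where
  open CommutativeℚAlgebra R
  open Arithmetic R
  open Hyperdeterminant R
  open FactorClosedSet x x≢0 x-injective closed
  open import Relation.Binary.Reasoning.Setoid setoid
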